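{- For all $n \geq 6$, \[\text{ex}_o(n,H_1)=\left\lfloor \frac{n}{2} \right\rfloor (n-2).\]
   Context: A $(2\to 1)$-graph (directed hypergraph) is a pair $H=(V,E)$ with $V$ a finite set and $E$ a set of pointed $3$-subsets of $V$: an edge, written $ab\to c$ (same as $ba\to c$), consists of three distinct vertices with head $c$ and tail set $\{a,b\}$. $H$ is oriented if every $3$-subset of $V$ carries at most one edge. $H$ is $F$-free if there is no injective map $\phi:V(F)\to V(H)$ such that $ab\to c\in E(F)$ implies $\phi(a)\phi(b)\to\phi(c)\in E(H)$. $\text{ex}_o(n,F)$ is the maximum number of edges of an $F$-free oriented $(2\to1)$-graph on $n$ vertices. $H_1$ is the $(2\to1)$-graph with vertex set $\{a,b,c,d,x\}$ (five distinct vertices) and edges $ax\to b$, $cx\to d$. -}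

module Defs where

open import Data.Bool.Base using (if_then_else_)
open import Data.Fin.Base using (Fin)
open import Data.Fin.Patterns
open import Data.Fin.Properties using (_≟_; _<?_)
open import Data.List.Base using (List; _∷_; [])
open import Data.List.Membership.Propositional using (_∈_)
import Data.List.Membership.DecPropositional as DecMembership
open import Data.List.Relation.Unary.Any using (here; there)
open import Data.Nat.Base using (ℕ; _≤_)
open import Data.Nat.Properties using (+-0-commutativeMonoid)
open import Data.Product.Base using (Σ; ∃; _×_; _,_)
open import Data.Product.Properties using (≡-dec)
open import Function.Definitions using (Injective)
open import Relation.Binary.PropositionalEquality using (_≡_; _≢_; refl)
open import Relation.Nullary using (¬_; Dec; does)
open import Relation.Nullary.Decidable using (_×-dec_)

open import Algebra.Properties.CommutativeMonoid.Sum +-0-commutativeMonoid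
  using (sum-syntax)

-- A (2→1)-graph on the vertex set Fin n.  Edge a b c is the edge ab → c with
-- tail set {a , b} and head c, so the unordered tail is represented by both
-- of its orderings.  Decidability makes the edges a finite set.
record Graph (n : ℕ) : Set₁ where
  field
    Edge     : Fin n → Fin n → Fin n → Set
    edge?    : ∀ a b c → Dec (Edge a b c)
    tail-sym : ∀ {a b c} → Edge a b c → Edge b a c
    distinct : ∀ {a b c} → Edge a b c → a ≢ b × a ≢ c × b ≢ c

open Graph public

-- The 3-subset {a , b , c} can carry only ab → c, ac → b and bc → a.  As a, b
-- and c range over all orderings, this says that no two of them coexist.
Oriented : ∀ {n} → Graph n → Set
Oriented H = ∀ a b c → Edge H a b c → ¬ Edge H a c b × ¬ Edge H b c a

_Contains_ : ∀ {n k} → Graph n → Graph k → Set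
_Contains_ {n} {k} H F =
  Σ (Fin k → Fin n) λ φ → Injective _≡_ _≡_ φ ×
    (∀ a b c → Edge F a b c → Edge H (φ a) (φ b) (φ c))

_Free : ∀ {k} → Graph k → ∀ {n} → Graph n → Set
(F Free) H = ¬ (H Contains F)

-- Each edge ab → c is counted once, at the ordering of its tail with a < b.
size : ∀ {n} → Graph n → ℕ
size {n} H =
  ∑[ a < n ] ∑[ b < n ] ∑[ c < n ]
    (if does ((a <? b) ×-dec edge? H a b c) then 1 else 0)

-- exₒ[ n , F ]≡ m : m is the maximum of size H over the F-free oriented
-- (2→1)-graphs H on n vertices.
exₒ[_,_]≡_ : ∀ {k} → ℕ → Graph k → ℕ → Set₁
exₒ[ n , F ]≡ m =
    (∃ λ (H : Graph n) → Oriented H × (F Free) H × size H ≡ m)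
  × (∀ (H : Graph n) → Oriented H → (F Free) H → size H ≤ m)

-- Vertices a, b, c, d, x are 0F, 1F, 2F, 3F, 4F; the edges are ax → b and
-- cx → d, each listed with both orderings of its tail.
H₁-edges : List (Fin 5 × Fin 5 × Fin 5)
H₁-edges = (0F , 4F , 1F) ∷ (4F , 0F , 1F)
         ∷ (2F , 4F , 3F) ∷ (4F , 2F , 3F) ∷ []

H₁ : Graph 5
H₁ = record
  { Edge     = λ a b c → (a , b , c) ∈ H₁-edges
  ; edge?    = λ a b c → (a , b , c) ∈? H₁-edges
  ; tail-sym = sym′
  ; distinct = distinct′
  }
  where
  open DecMembership (≡-dec _≟_ (≡-dec _≟_ _≟_)) using (_∈?_)

  sym′ : ∀ {a b c} → (a , b , c) ∈ H₁-edges → (b , a , c) ∈ H₁-edges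
  sym′ (here refl)                         = there (here refl)
  sym′ (there (here refl))                 = here refl
  sym′ (there (there (here refl)))         = there (there (there (here refl)))
  sym′ (there (there (there (here refl)))) = there (there (here refl))

  distinct′ : ∀ {a b c} → (a , b , c) ∈ H₁-edges → a ≢ b × a ≢ c × b ≢ c
  distinct′ (here refl)                         = (λ ()) , (λ ()) , (λ ())
  distinct′ (there (here refl))                 = (λ ()) , (λ ()) , (λ ())
  distinct′ (there (there (here refl)))         = (λ ()) , (λ ()) , (λ ())
  distinct′ (there (there (there (here refl)))) = (λ ()) , (λ ()) , (λ ())

{-# OPTIONS --safe #-}
module Submission where

-- In an H₁-free graph no two arcs of the link digraph of x (b → c for the edge
-- xb → c) are disjoint, so the link lies in a star with some centre f x or in a
-- triangle.  As H is oriented, x is in at most n − 2 tails, and in at most 3 for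
-- a triangle.  Summing over x gives 2|E| ≤ n(n − 2), which settles even n.
--
-- For odd n with all links stars, an edge ab → c forces f a ∈ {b , c} and
-- f b ∈ {a , c}: its 3-set keeps at least two of its vertices inside under f.
-- The numbers of kept vertices sum to n(n − 2) over all 3-sets.  This is odd, so
-- some 3-set is odd; the four 3-sets of a 4-set have even sum, so at least n − 2
-- of the 3-sets are odd, and each of them wastes a unit:
-- 2|E| ≤ n(n − 2) − (n − 2).
-- Two triangle links lose enough already in the degree sum.  For a single one,
-- on {p , q , r} at x, put f x = p: only the 3-set {x , q , r} can carry an edge
-- while keeping a single vertex.  If it does, it is odd itself, and a 3-set
-- {x , p , y} wastes a further unit, which is enough by parity.
--
-- The bound is attained by the edges xx′ → c for a matching {x , x′} of the
-- vertices.

open import Defs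
open import Data.Bool.Base using (if_then_else_)
open import Data.Fin.Base using (Fin; zero; suc)
open import Data.Fin.Patterns
open import Data.Fin.Properties using (_≟_; _<?_; any?; all?; <-cmp)
open import Data.List.Relation.Unary.Any using (here; there)
open import Data.Nat.Base hiding (parity)
open import Data.Nat.DivMod using (_%_; _/_; m%n<n; m%n≤m; m≡m%n+[m/n]*n)
open import Data.Nat.Divisibility
open import Data.Nat.Properties renaming (_≟_ to _≟ℕ_) hiding (_<?_; <-cmp)
open import Data.Nat.Tactic.RingSolver using (solve-∀)
open import Data.Product.Base using (∃; _×_; _,_; proj₁; proj₂)
open import Data.Sum.Base using (_⊎_; inj₁; inj₂; [_,_]′)
open import Data.Vec.Base using (lookup; _∷_; [])
open import Data.Vec.Relation.Unary.All using (_∷_; [])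
open import Data.Vec.Relation.Unary.AllPairs using (AllPairs; _∷_; [])
open import Data.Vec.Relation.Unary.Unique.Propositional.Properties using (lookup-injective)
open import Function.Base using (_∘_; const; id)
open import Relation.Binary.Definitions using (tri<; tri≈; tri>)
open import Relation.Binary.PropositionalEquality
open import Relation.Nullary
open import Relation.Nullary.Decidable using (_×-dec_; _⊎-dec_; _→-dec_; ¬?)

open import Algebra.Properties.Semiring.Sum +-*-semiring
  using (sum; sum-syntax; sum-cong-≗; ∑-distrib-+; ∑-comm; *-distribˡ-sum)

-- Indicators and finite sums.

-- The shape `if does d then 1 else 0` is that of the summand in `size`, so `size` is a sum of such
-- indicators by computation.
⟦_⟧ : ∀ {P : Set} → Dec P → ℕ
⟦ d ⟧ = if does d then 1 else 0

⟦⟧-yes : ∀ {P : Set} (d : Dec P) → P → ⟦ d ⟧ ≡ 1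
⟦⟧-yes (yes _) _ = refl
⟦⟧-yes (no ¬p) p = contradiction p ¬p

⟦⟧-no : ∀ {P : Set} (d : Dec P) → ¬ P → ⟦ d ⟧ ≡ 0
⟦⟧-no (yes p) ¬p = contradiction p ¬p
⟦⟧-no (no _)  _  = refl

⟦⟧-cong : ∀ {P Q : Set} (d : Dec P) (d′ : Dec Q) → (P → Q) → (Q → P) → ⟦ d ⟧ ≡ ⟦ d′ ⟧
⟦⟧-cong (yes p) d′ f _ = sym (⟦⟧-yes d′ (f p))
⟦⟧-cong (no ¬p) d′ _ g = sym (⟦⟧-no d′ (¬p ∘ g))

⟦⟧≤1 : ∀ {P : Set} (d : Dec P) → ⟦ d ⟧ ≤ 1
⟦⟧≤1 (yes _) = ≤-refl
⟦⟧≤1 (no _)  = z≤n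

δ : ∀ {n} → Fin n → Fin n → ℕ
δ a b = ⟦ a ≟ b ⟧

∑-mono : ∀ {n} {f g : Fin n → ℕ} → (∀ i → f i ≤ g i) → sum f ≤ sum g
∑-mono {zero}  _   = z≤n
∑-mono {suc n} f≤g = +-mono-≤ (f≤g zero) (∑-mono (f≤g ∘ suc))

∑-const : ∀ n k → ∑[ _ < n ] k ≡ n * k
∑-const zero    k = refl
∑-const (suc n) k = cong (k +_) (∑-const n k)

∑-one : ∀ n → ∑[ _ < n ] 1 ≡ n
∑-one n = trans (∑-const n 1) (*-identityʳ n)

∑-zero : ∀ {n} {f : Fin n → ℕ} → (∀ i → f i ≡ 0) → sum f ≡ 0
∑-zero {n} f≡0 = trans (sum-cong-≗ f≡0) (trans (∑-const n 0) (*-zeroʳ n))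

∑-*ˡ : ∀ {n} k (f : Fin n → ℕ) → ∑[ i < n ] (k * f i) ≡ k * sum f
∑-*ˡ k f = sym (*-distribˡ-sum k f)

∑-δ : ∀ {n} (a : Fin n) (g : Fin n → ℕ) → ∑[ x < n ] (δ a x * g x) ≡ g a
∑-δ {suc n} zero g = trans (cong (1 * g zero +_) (∑-zero {n} λ _ → refl)) (solve (g zero))
  where solve : ∀ m → 1 * m + 0 ≡ m
        solve = solve-∀
-- The summand at `zero` computes to 0 and `δ (suc a) (suc x)` to `δ a x`, so the recursive call
-- already has the required type.
∑-δ (suc a) g = ∑-δ a (g ∘ suc)

∑-δ₁ : ∀ {n} (a : Fin n) → ∑[ x < n ] δ a x ≡ 1
∑-δ₁ a = trans (sum-cong-≗ λ x → sym (*-identityʳ (δ a x))) (∑-δ a (const 1))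

-- Sums over ordered triples.

Triple : ℕ → Set
Triple n = Fin n → Fin n → Fin n → ℕ

∑³ : ∀ {n} → Triple n → ℕ
∑³ {n} F = ∑[ a < n ] ∑[ b < n ] ∑[ c < n ] F a b c

module _ {n : ℕ} where

  ∑³-cong : {F G : Triple n} → (∀ a b c → F a b c ≡ G a b c) → ∑³ F ≡ ∑³ G
  ∑³-cong F≡G = sum-cong-≗ λ a → sum-cong-≗ λ b → sum-cong-≗ (F≡G a b)

  ∑³-mono : {F G : Triple n} → (∀ a b c → F a b c ≤ G a b c) → ∑³ F ≤ ∑³ G
  ∑³-mono F≤G = ∑-mono λ a → ∑-mono λ b → ∑-mono (F≤G a b)

  ∑³-+ : (F G : Triple n) → ∑³ (λ a b c → F a b c + G a b c) ≡ ∑³ F + ∑³ G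
  ∑³-+ F G = trans
    (sum-cong-≗ λ a → trans (sum-cong-≗ λ b → ∑-distrib-+ (F a b) (G a b))
                            (∑-distrib-+ (λ b → sum (F a b)) (λ b → sum (G a b))))
    (∑-distrib-+ (λ a → ∑[ b < n ] sum (F a b)) (λ a → ∑[ b < n ] sum (G a b)))

  ∑³-*ˡ : ∀ k (F : Triple n) → ∑³ (λ a b c → k * F a b c) ≡ k * ∑³ F
  ∑³-*ˡ k F = trans
    (sum-cong-≗ λ a → trans (sum-cong-≗ λ b → ∑-*ˡ k (F a b)) (∑-*ˡ k (λ b → sum (F a b))))
    (∑-*ˡ k (λ a → ∑[ b < n ] sum (F a b)))

  ∑³-swap₁₂ : (F : Triple n) → ∑³ (λ a b c → F b a c) ≡ ∑³ F
  ∑³-swap₁₂ F = ∑-comm λ a b → sum (F b a)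

  ∑³-swap₂₃ : (F : Triple n) → ∑³ (λ a b c → F a c b) ≡ ∑³ F
  ∑³-swap₂₃ F = sum-cong-≗ λ a → ∑-comm λ b c → F a c b

  ∑³-rotate : (F : Triple n) → ∑³ (λ a b c → F b c a) ≡ ∑³ F
  ∑³-rotate F = trans (∑³-swap₁₂ λ a b c → F a c b) (∑³-swap₂₃ F)

  -- Encodes a function on 3-subsets by its values on ordered triples: the two transpositions
  -- generate all permutations, and degenerate triples are sent to 0.
  record Symmetric₃ (F : Triple n) : Set where
    field
      swap₁₂ : ∀ a b c → F a b c ≡ F b a c
      swap₂₃ : ∀ a b c → F a b c ≡ F a c b
      diag   : ∀ a c → F a a c ≡ 0

    rotate : ∀ a b c → F a b c ≡ F b c a
    rotate a b c = trans (swap₁₂ a b c) (swap₂₃ b a c)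

    diag₁₃ : ∀ a b → F a b a ≡ 0
    diag₁₃ a b = trans (swap₂₃ a b a) (diag a b)

    diag₂₃ : ∀ a b → F a b b ≡ 0
    diag₂₃ a b = trans (rotate a b b) (diag b a)

open Symmetric₃

-- Divisibility of symmetric sums.

-- Once vertex `zero` is split off, its row and its column have the same sum `R`, and what remains
-- is again symmetric.
2∣∑² : ∀ n (G : Fin n → Fin n → ℕ) → (∀ a b → G a b ≡ G b a) → (∀ a → G a a ≡ 0) →
       2 ∣ ∑[ a < n ] ∑[ b < n ] G a b
2∣∑² zero    G _   _    = 2 ∣0
2∣∑² (suc n) G comm zero-diag = subst (2 ∣_) (sym eq) (∣m∣n⇒∣m+n (m∣m*n R)
  (2∣∑² n (λ a b → G (suc a) (suc b)) (λ a b → comm (suc a) (suc b)) (zero-diag ∘ suc)))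
  where
  R = ∑[ b < n ] G zero (suc b)
  S = ∑[ a < n ] ∑[ b < n ] G (suc a) (suc b)
  solve : ∀ r s → (0 + r) + (r + s) ≡ 2 * r + s
  solve = solve-∀
  eq : ∑[ a < suc n ] ∑[ b < suc n ] G a b ≡ 2 * R + S
  eq = trans (cong₂ (λ g k → (g + R) + k) (zero-diag zero)
         (trans (∑-distrib-+ (λ a → G (suc a) zero) _)
                (cong (_+ S) (sum-cong-≗ λ a → comm (suc a) zero))))
       (solve R S)

-- Vertex `zero` can stand in any of three positions. Each contributes the same double sum `P`,
-- which is even by `2∣∑²`, and the remaining triples fall to induction.
6∣∑³ : ∀ n (F : Triple n) → Symmetric₃ F → 6 ∣ ∑³ F
6∣∑³ zero    F _ = 6 ∣0
6∣∑³ (suc n) F S = subst (6 ∣_) (sym eq)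
  (∣m∣n⇒∣m+n (*-monoʳ-∣ 3 (2∣∑² n (λ b c → F zero (suc b) (suc c))
                                    (λ b c → swap₂₃ S zero (suc b) (suc c))
                                    (λ b → diag₂₃ S zero (suc b))))
             (6∣∑³ n F′ record { swap₁₂ = λ a b c → swap₁₂ S (suc a) (suc b) (suc c)
                                ; swap₂₃ = λ a b c → swap₂₃ S (suc a) (suc b) (suc c)
                                ; diag = λ a c → diag S (suc a) (suc c) }))
  where
  F′ : Triple n
  F′ a b c = F (suc a) (suc b) (suc c)
  P = ∑[ b < n ] ∑[ c < n ] F zero (suc b) (suc c)
  solve : ∀ p f → p + (p + (p + f)) ≡ 3 * p + f
  solve = solve-∀
  row₀ : ∑[ b < suc n ] ∑[ c < suc n ] F zero b c ≡ P
  row₀ = cong₂ _+_ (∑-zero λ c → diag S zero c)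
                   (sum-cong-≗ λ b → cong (_+ ∑[ c < n ] F zero (suc b) (suc c)) (diag₁₃ S zero (suc b)))
  -- The three terms are the triples with `zero` in second position, those with `zero` in third
  -- position, and those without `zero`.
  row : ∀ a → ∑[ b < suc n ] ∑[ c < suc n ] F (suc a) b c ≡
              ∑[ c < n ] F zero (suc a) (suc c) +
              (∑[ b < n ] F zero (suc a) (suc b) + ∑[ b < n ] ∑[ c < n ] F′ a b c)
  row a = cong₂ _+_ (cong₂ _+_ (diag₂₃ S (suc a) zero) (sum-cong-≗ λ c → swap₁₂ S (suc a) zero (suc c)))
            (trans (∑-distrib-+ (λ b → F (suc a) (suc b) zero) _)
                   (cong (_+ ∑[ b < n ] ∑[ c < n ] F′ a b c)
                         (sum-cong-≗ λ b → trans (rotate S (suc a) (suc b) zero) (rotate S (suc b) zero (suc a)))))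
  eq : ∑³ F ≡ 3 * P + ∑³ F′
  eq = trans (cong₂ _+_ row₀ (trans (sum-cong-≗ row)
         (trans (∑-distrib-+ (λ a → ∑[ c < n ] F zero (suc a) (suc c)) _)
                (cong (P +_) (∑-distrib-+ (λ a → ∑[ c < n ] F zero (suc a) (suc c)) _)))))
       (solve P (∑³ F′))

-- Triples of distinct vertices.

module _ {n : ℕ} where

  Distinct : Fin n → Fin n → Fin n → Set
  Distinct a b c = a ≢ b × a ≢ c × b ≢ c

  distinct? : ∀ a b c → Dec (Distinct a b c)
  distinct? a b c = ¬? (a ≟ b) ×-dec ¬? (a ≟ c) ×-dec ¬? (b ≟ c)

  D : Triple n
  D a b c = ⟦ distinct? a b c ⟧

  Distinct-swap₁₂ : ∀ {a b c} → Distinct a b c → Distinct b a c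
  Distinct-swap₁₂ (a≢b , a≢c , b≢c) = ≢-sym a≢b , b≢c , a≢c

  Distinct-swap₂₃ : ∀ {a b c} → Distinct a b c → Distinct a c b
  Distinct-swap₂₃ (a≢b , a≢c , b≢c) = a≢c , a≢b , ≢-sym b≢c

  D-distinct : ∀ {a b c} → Distinct a b c → D a b c ≡ 1
  D-distinct {a} {b} {c} = ⟦⟧-yes (distinct? a b c)

  D-symmetric : Symmetric₃ D
  D-symmetric .swap₁₂ a b c = ⟦⟧-cong (distinct? a b c) (distinct? b a c) Distinct-swap₁₂ Distinct-swap₁₂
  D-symmetric .swap₂₃ a b c = ⟦⟧-cong (distinct? a b c) (distinct? a c b) Distinct-swap₂₃ Distinct-swap₂₃
  D-symmetric .diag a c = ⟦⟧-no (distinct? a a c) λ (a≢a , _) → a≢a refl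

  Distinct-elim : ∀ {F} → Symmetric₃ F → ∀ a b c → Distinct a b c ⊎ F a b c ≡ 0
  Distinct-elim {F} S a b c with a ≟ b | a ≟ c | b ≟ c
  ... | yes refl | _ | _ = inj₂ (diag S a c)
  ... | no _ | yes refl | _ = inj₂ (diag₁₃ S a b)
  ... | no _ | no _ | yes refl = inj₂ (diag₂₃ S a b)
  ... | no p | no q | no r = inj₁ (p , q , r)

  -- Each `c` is distinct from both `a` and `b` or equals exactly one of them, so the three
  -- indicators add up to 1.
  ∑-D : ∀ {a b} → a ≢ b → ∑[ c < n ] D a b c + 2 ≡ n
  ∑-D {a} {b} a≢b = begin
    ∑[ c < n ] D a b c + 2
      ≡⟨ cong (∑[ c < n ] D a b c +_) (cong₂ _+_ (∑-δ₁ a) (∑-δ₁ b)) ⟨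
    ∑[ c < n ] D a b c + (∑[ c < n ] δ a c + ∑[ c < n ] δ b c)
      ≡⟨ cong (∑[ c < n ] D a b c +_) (∑-distrib-+ (δ a) (δ b)) ⟨
    ∑[ c < n ] D a b c + ∑[ c < n ] (δ a c + δ b c)
      ≡⟨ ∑-distrib-+ (D a b) (λ c → δ a c + δ b c) ⟨
    ∑[ c < n ] (D a b c + (δ a c + δ b c))
      ≡⟨ sum-cong-≗ one ⟩
    ∑[ c < n ] 1
      ≡⟨ ∑-one n ⟩
    n ∎
    where
    open ≡-Reasoning
    one : ∀ c → D a b c + (δ a c + δ b c) ≡ 1
    one c with a ≟ b | a ≟ c | b ≟ c
    ... | yes p | _ | _ = contradiction p a≢b
    ... | no _ | yes refl | yes refl = contradiction refl a≢b
    ... | no _ | yes _ | no _ = refl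
    ... | no _ | no _ | yes _ = refl
    ... | no _ | no _ | no _ = refl

  ∑-D∸ : ∀ {a b} → a ≢ b → ∑[ c < n ] D a b c ≡ n ∸ 2
  ∑-D∸ {a} {b} a≢b = sym (trans (cong (_∸ 2) (sym (∑-D a≢b))) (m+n∸n≡m _ 2))

  ∑-D≤ : ∀ a b → ∑[ c < n ] D a b c ≤ n ∸ 2
  ∑-D≤ a b = go (a ≟ b)
    where
    go : Dec (a ≡ b) → ∑[ c < n ] D a b c ≤ n ∸ 2
    go (yes refl) = ≤-trans (≤-reflexive (∑-zero (diag D-symmetric a))) z≤n
    go (no a≢b)   = ≤-reflexive (∑-D∸ a≢b)

  -- Serves twice: with the star centres for counting kept vertices, and with `partner` for counting
  -- the edges of the extremal graph.
  ∑³-δ-D : (g : Fin n → Fin n) → ∑³ (λ a b c → δ (g a) b * D a b c) ≡ ∑[ a < n ] sum (D a (g a))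
  ∑³-δ-D g = sum-cong-≗ λ a →
    trans (sum-cong-≗ λ b → ∑-*ˡ (δ (g a) b) (D a b)) (∑-δ (g a) (λ b → sum (D a b)))

-- The indicator of a fixed 3-set.

module _ {n : ℕ} (a b c : Fin n) where

  Member : Fin n → Set
  Member x = x ≡ a ⊎ x ≡ b ⊎ x ≡ c

  member? : ∀ x → Dec (Member x)
  member? x = x ≟ a ⊎-dec x ≟ b ⊎-dec x ≟ c

  χ : Fin n → ℕ
  χ x = ⟦ member? x ⟧

  χ³ : Triple n
  χ³ x y z = χ x * (χ y * χ z)

  -- Takes the values 0, 0, 1, 3 as zero, one, two or three of the vertices `x`, `y`, `z` lie in the
  -- set.
  χ-pairs : Triple n
  χ-pairs x y z = χ x * χ y + χ x * χ z + χ y * χ z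

  module _ (abc : Distinct a b c) where

    private
      a≢b = proj₁ abc
      a≢c = proj₁ (proj₂ abc)
      b≢c = proj₂ (proj₂ abc)

    χ-δ : ∀ x → χ x ≡ δ a x + (δ b x + δ c x)
    χ-δ x with x ≟ a | x ≟ b | x ≟ c
    ... | yes refl | _ | _ = sym (cong₂ _+_ (⟦⟧-yes (x ≟ x) refl)
            (cong₂ _+_ (⟦⟧-no (b ≟ x) (≢-sym a≢b)) (⟦⟧-no (c ≟ x) (≢-sym a≢c))))
    ... | no p | yes refl | _ = sym (cong₂ _+_ (⟦⟧-no (a ≟ x) a≢b)
            (cong₂ _+_ (⟦⟧-yes (x ≟ x) refl) (⟦⟧-no (c ≟ x) (≢-sym b≢c))))
    ... | no p | no q | yes refl = sym (cong₂ _+_ (⟦⟧-no (a ≟ x) a≢c)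
            (cong₂ _+_ (⟦⟧-no (b ≟ x) b≢c) (⟦⟧-yes (x ≟ x) refl)))
    ... | no p | no q | no r = sym (cong₂ _+_ (⟦⟧-no (a ≟ x) (≢-sym p))
            (cong₂ _+_ (⟦⟧-no (b ≟ x) (≢-sym q)) (⟦⟧-no (c ≟ x) (≢-sym r))))

    ∑-χ : ∀ g → ∑[ x < n ] (χ x * g x) ≡ g a + (g b + g c)
    ∑-χ g = begin
      ∑[ x < n ] (χ x * g x)
        ≡⟨ sum-cong-≗ (λ x → trans (cong (_* g x) (χ-δ x)) (expand (δ a x) (δ b x) (δ c x) (g x))) ⟩
      ∑[ x < n ] (δ a x * g x + (δ b x * g x + δ c x * g x))
        ≡⟨ ∑-distrib-+ (λ x → δ a x * g x) _ ⟩
      ∑[ x < n ] (δ a x * g x) + ∑[ x < n ] (δ b x * g x + δ c x * g x)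
        ≡⟨ cong (∑[ x < n ] (δ a x * g x) +_) (∑-distrib-+ (λ x → δ b x * g x) _) ⟩
      ∑[ x < n ] (δ a x * g x) + (∑[ x < n ] (δ b x * g x) + ∑[ x < n ] (δ c x * g x))
        ≡⟨ cong₂ _+_ (∑-δ a g) (cong₂ _+_ (∑-δ b g) (∑-δ c g)) ⟩
      g a + (g b + g c) ∎
      where
      open ≡-Reasoning
      expand : ∀ u v w k → (u + (v + w)) * k ≡ u * k + (v * k + w * k)
      expand = solve-∀

    ∑²-χ : ∀ (G : Fin n → Fin n → ℕ) → (∀ x y → G x y ≡ G y x) → (∀ x → G x x ≡ 0) →
           ∑[ x < n ] ∑[ y < n ] (χ x * (χ y * G x y)) ≡ 2 * (G a b + (G a c + G b c))
    ∑²-χ G comm zero-diag = begin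
      ∑[ x < n ] ∑[ y < n ] (χ x * (χ y * G x y))
        ≡⟨ sum-cong-≗ (λ x → trans (∑-*ˡ (χ x) (λ y → χ y * G x y)) (cong (χ x *_) (∑-χ (G x)))) ⟩
      ∑[ x < n ] (χ x * (G x a + (G x b + G x c)))
        ≡⟨ ∑-χ (λ x → G x a + (G x b + G x c)) ⟩
      (G a a + (G a b + G a c)) + ((G b a + (G b b + G b c)) + (G c a + (G c b + G c c)))
        ≡⟨ cong₂ _+_ (cong (_+ (G a b + G a c)) (zero-diag a))
             (cong₂ _+_ (cong₂ _+_ (comm b a) (cong (_+ G b c) (zero-diag b)))
                        (cong₂ _+_ (comm c a) (cong₂ _+_ (comm c b) (zero-diag c)))) ⟩
      (0 + (G a b + G a c)) + ((G a b + (0 + G b c)) + (G a c + (G b c + 0)))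
        ≡⟨ collect (G a b) (G a c) (G b c) ⟩
      2 * (G a b + (G a c + G b c)) ∎
      where
      open ≡-Reasoning
      collect : ∀ u v w → (0 + (u + v)) + ((u + (0 + w)) + (v + (w + 0))) ≡ 2 * (u + (v + w))
      collect = solve-∀

    -- Only the six orderings of `a`, `b`, `c` survive, and `F` has the same value at all of them.
    ∑³-χ³ : ∀ {F : Triple n} → Symmetric₃ F → ∑³ (λ x y z → χ³ x y z * F x y z) ≡ 6 * F a b c
    ∑³-χ³ {F} S = begin
      ∑³ (λ x y z → χ³ x y z * F x y z)
        ≡⟨ ∑³-cong (λ x y z → assoc (χ x) (χ y) (χ z) (F x y z)) ⟩
      ∑³ (λ x y z → χ x * χ y * (χ z * F x y z))
        ≡⟨ sum-cong-≗ (λ x → sum-cong-≗ λ y → trans (∑-*ˡ (χ x * χ y) (λ z → χ z * F x y z))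
              (trans (cong (χ x * χ y *_) (∑-χ (F x y))) (*-assoc (χ x) (χ y) _))) ⟩
      ∑[ x < n ] ∑[ y < n ] (χ x * (χ y * G x y))
        ≡⟨ ∑²-χ G (λ x y → cong₂ _+_ (swap₁₂ S x y a) (cong₂ _+_ (swap₁₂ S x y b) (swap₁₂ S x y c)))
                  (λ x → cong₂ _+_ (diag S x a) (cong₂ _+_ (diag S x b) (diag S x c))) ⟩
      2 * (G a b + (G a c + G b c))
        ≡⟨ cong (2 *_) (cong₂ _+_ (cong₂ _+_ (diag₁₃ S a b) (cong (_+ F a b c) (diag₂₃ S a b)))
             (cong₂ _+_ (cong₂ _+_ (diag₁₃ S a c) (cong₂ _+_ (swap₂₃ S a c b) (diag₂₃ S a c)))
                        (cong₂ _+_ (sym (rotate S a b c)) (cong₂ _+_ (diag₁₃ S b c) (diag₂₃ S b c))))) ⟩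
      2 * ((0 + (0 + F a b c)) + ((0 + (F a b c + 0)) + (F a b c + (0 + 0))))
        ≡⟨ collect (F a b c) ⟩
      6 * F a b c ∎
      where
      open ≡-Reasoning
      G : Fin n → Fin n → ℕ
      G x y = F x y a + (F x y b + F x y c)
      assoc : ∀ u v w k → (u * (v * w)) * k ≡ u * v * (w * k)
      assoc = solve-∀
      collect : ∀ k → 2 * ((0 + (0 + k)) + ((0 + (k + 0)) + (k + (0 + 0)))) ≡ 6 * k
      collect = solve-∀

    -- By symmetry each choice of the unconstrained position gives the same sum, and in each of the
    -- three every pair from `{a , b , c}` occurs in two orders. The vertex `z` also runs through
    -- `a`, `b`, `c`, so `F a b c` itself enters three times on the right under the sum.
    ∑³-χ-pairs : ∀ {F : Triple n} → Symmetric₃ F →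
      ∑³ (λ x y z → χ-pairs x y z * F x y z) ≡ 6 * ∑[ z < n ] (F z a b + (F z a c + F z b c))
    ∑³-χ-pairs {F} S = begin
      ∑³ (λ x y z → χ-pairs x y z * F x y z)
        ≡⟨ ∑³-cong (λ x y z → expand (χ x) (χ y) (χ z) (F x y z)) ⟩
      ∑³ (λ x y z → Q₁₂ x y z + (Q₁₃ x y z + Q x y z))
        ≡⟨ trans (∑³-+ Q₁₂ (λ x y z → Q₁₃ x y z + Q x y z)) (cong (∑³ Q₁₂ +_) (∑³-+ Q₁₃ Q)) ⟩
      ∑³ Q₁₂ + (∑³ Q₁₃ + ∑³ Q)
        ≡⟨ cong₂ _+_ (trans (∑³-cong λ x y z → cong (λ k → χ x * (χ y * k)) (sym (rotate S z x y))) (∑³-rotate′ Q))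
             (cong (_+ ∑³ Q) (trans (∑³-cong λ x y z → cong (λ k → χ x * (χ z * k)) (swap₁₂ S x y z))
                                    (∑³-swap₁₂ Q))) ⟩
      ∑³ Q + (∑³ Q + ∑³ Q)
        ≡⟨ cong (λ q → q + (q + q)) (trans (sum-cong-≗ λ x → ∑²-χ (F x) (swap₂₃ S x) (diag₂₃ S x)) (∑-*ˡ 2 T)) ⟩
      2 * sum T + (2 * sum T + 2 * sum T)
        ≡⟨ collect (sum T) ⟩
      6 * sum T ∎
      where
      open ≡-Reasoning
      Q₁₂ Q₁₃ Q : Triple n
      Q₁₂ x y z = χ x * (χ y * F x y z)
      Q₁₃ x y z = χ x * (χ z * F x y z)
      Q x y z = χ y * (χ z * F x y z)
      T : Fin n → ℕ
      T z = F z a b + (F z a c + F z b c)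
      ∑³-rotate′ : (K : Triple n) → ∑³ (λ x y z → K z x y) ≡ ∑³ K
      ∑³-rotate′ K = sym (∑³-rotate (λ x y z → K z x y))
      expand : ∀ u v w k → (u * v + u * w + v * w) * k ≡ u * (v * k) + (u * (w * k) + v * (w * k))
      expand = solve-∀
      collect : ∀ k → 2 * k + (2 * k + 2 * k) ≡ 6 * k
      collect = solve-∀

  -- The two adjacent transpositions lead from `a b c` to all six orderings; every other assignment
  -- repeats a vertex.
  permutation-elim : (P : Fin n → Fin n → Fin n → Set) →
    (∀ {x y z} → P x y z → P y x z) → (∀ {x y z} → P x y z → P x z y) → P a b c →
    ∀ {x y z} → Distinct x y z → Member x → Member y → Member z → P x y z
  permutation-elim P s₁ s₂ p {x} {y} {z} (x≢y , x≢z , y≢z) = go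
    where
    go : Member x → Member y → Member z → P x y z
    go (inj₁ refl) (inj₁ refl) _ = contradiction refl x≢y
    go (inj₂ (inj₁ refl)) (inj₂ (inj₁ refl)) _ = contradiction refl x≢y
    go (inj₂ (inj₂ refl)) (inj₂ (inj₂ refl)) _ = contradiction refl x≢y
    go (inj₁ refl) _ (inj₁ refl) = contradiction refl x≢z
    go (inj₂ (inj₁ refl)) _ (inj₂ (inj₁ refl)) = contradiction refl x≢z
    go (inj₂ (inj₂ refl)) _ (inj₂ (inj₂ refl)) = contradiction refl x≢z
    go _ (inj₁ refl) (inj₁ refl) = contradiction refl y≢z
    go _ (inj₂ (inj₁ refl)) (inj₂ (inj₁ refl)) = contradiction refl y≢z
    go _ (inj₂ (inj₂ refl)) (inj₂ (inj₂ refl)) = contradiction refl y≢z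
    go (inj₁ refl) (inj₂ (inj₁ refl)) (inj₂ (inj₂ refl)) = p
    go (inj₁ refl) (inj₂ (inj₂ refl)) (inj₂ (inj₁ refl)) = s₂ p
    go (inj₂ (inj₁ refl)) (inj₁ refl) (inj₂ (inj₂ refl)) = s₁ p
    go (inj₂ (inj₁ refl)) (inj₂ (inj₂ refl)) (inj₁ refl) = s₂ (s₁ p)
    go (inj₂ (inj₂ refl)) (inj₁ refl) (inj₂ (inj₁ refl)) = s₁ (s₂ p)
    go (inj₂ (inj₂ refl)) (inj₂ (inj₁ refl)) (inj₁ refl) = s₂ (s₁ (s₂ p))

-- Parity.

m%2≡0∨1 : ∀ m → m % 2 ≡ 0 ⊎ m % 2 ≡ 1
m%2≡0∨1 m with m % 2 | m%n<n m 2
... | 0 | _ = inj₁ refl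
... | 1 | _ = inj₂ refl
... | suc (suc _) | s≤s (s≤s ())

m%2≡0⇒even : ∀ m → m % 2 ≡ 0 → m ≡ 2 * (m / 2)
m%2≡0⇒even m eq = trans (m≡m%n+[m/n]*n m 2) (trans (cong (_+ m / 2 * 2) eq) (*-comm (m / 2) 2))


-- If `p`, `q` and `r` were all even, `s` would be even too. The four numbers will belong to the
-- four 3-sets of a 4-set.
odd-summand : ∀ s p q r → s % 2 ≡ 1 → 2 ∣ s + (p + (q + r)) → 1 ≤ p % 2 + (q % 2 + r % 2)
odd-summand s p q r s-odd even with m%2≡0∨1 p | m%2≡0∨1 q | m%2≡0∨1 r
... | inj₂ eq | _ | _ = ≤-trans (≤-reflexive (sym eq)) (m≤m+n _ _)
... | inj₁ _ | inj₂ eq | _ = ≤-trans (≤-reflexive (sym eq)) (≤-trans (m≤m+n _ _) (m≤n+m _ (p % 2)))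
... | inj₁ _ | inj₁ _ | inj₂ eq = ≤-trans (≤-reflexive (sym eq)) (≤-trans (m≤n+m _ (q % 2)) (m≤n+m _ (p % 2)))
... | inj₁ p₀ | inj₁ q₀ | inj₁ r₀ = contradiction (trans (sym s-odd) (n∣m⇒m%n≡0 s 2 2∣s)) λ ()
  where
  2∣rest : 2 ∣ p + (q + r)
  2∣rest = ∣m∣n⇒∣m+n (m%n≡0⇒n∣m p 2 p₀) (∣m∣n⇒∣m+n (m%n≡0⇒n∣m q 2 q₀) (m%n≡0⇒n∣m r 2 r₀))
  2∣s : 2 ∣ s
  2∣s = ∣m+n∣m⇒∣n (subst (2 ∣_) (+-comm s _) even) 2∣rest

-- Vertices kept inside a 3-set by a function.

module FunctionalGraph {n : ℕ} (f : Fin n → Fin n) (f-irrefl : ∀ a → f a ≢ a) where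

  out : Triple n
  out a b c = δ (f a) b + δ (f a) c

  -- On a genuine 3-set this is the number of vertices that `f` keeps inside. The factor `D` makes
  -- it vanish on degenerate triples, as `Symmetric₃` demands.
  arcs : Triple n
  arcs a b c = D a b c * (out a b c + out b a c + out c a b)

  arcs-symmetric : Symmetric₃ arcs
  arcs-symmetric .swap₁₂ a b c = cong₂ _*_ (swap₁₂ D-symmetric a b c) (begin
    out a b c + out b a c + out c a b
      ≡⟨ cong₂ _+_ (+-comm (out a b c) (out b a c)) (+-comm (δ (f c) a) (δ (f c) b)) ⟩
    out b a c + out a b c + out c b a ∎)
    where open ≡-Reasoning
  arcs-symmetric .swap₂₃ a b c = cong₂ _*_ (swap₂₃ D-symmetric a b c)
    (rearrange (δ (f a) b) (δ (f a) c) (out b a c) (out c a b))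
    where
    rearrange : ∀ u v p q → u + v + p + q ≡ v + u + q + p
    rearrange = solve-∀
  arcs-symmetric .diag a c = cong (_* (out a a c + out a a c + out c a a)) (diag D-symmetric a c)

  -- Sums over ordered triples count every 3-subset 6 times.
  ∑³-arcs : ∑³ arcs ≡ 6 * (n * (n ∸ 2))
  ∑³-arcs = begin
    ∑³ arcs
      ≡⟨ ∑³-cong expand ⟩
    ∑³ (λ a b c → L a b c + (L b a c + L c a b))
      ≡⟨ ∑³-+ L (λ a b c → L b a c + L c a b) ⟩
    ∑³ L + ∑³ (λ a b c → L b a c + L c a b)
      ≡⟨ cong (∑³ L +_) (∑³-+ (λ a b c → L b a c) (λ a b c → L c a b)) ⟩
    ∑³ L + (∑³ (λ a b c → L b a c) + ∑³ (λ a b c → L c a b))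
      ≡⟨ cong (∑³ L +_) (cong₂ _+_ (∑³-swap₁₂ L) (sym (∑³-rotate (λ a b c → L c a b)))) ⟩
    ∑³ L + (∑³ L + ∑³ L)
      ≡⟨ cong (λ l → l + (l + l)) (trans (∑³-+ K (λ a b c → K a c b))
           (cong₂ _+_ ∑³-K (trans (∑³-swap₂₃ K) ∑³-K))) ⟩
    (N + N) + ((N + N) + (N + N))
      ≡⟨ collect N ⟩
    6 * N ∎
    where
    open ≡-Reasoning
    N = n * (n ∸ 2)
    K L : Triple n
    K a b c = δ (f a) b * D a b c
    L a b c = K a b c + K a c b
    collect : ∀ m → (m + m) + ((m + m) + (m + m)) ≡ 6 * m
    collect = solve-∀
    distribute : ∀ d p q r s t u →
      d * ((p + q) + (r + s) + (t + u)) ≡ (p * d + q * d) + ((r * d + s * d) + (t * d + u * d))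
    distribute = solve-∀
    expand : ∀ a b c → arcs a b c ≡ L a b c + (L b a c + L c a b)
    expand a b c = trans
      (distribute (D a b c) (δ (f a) b) (δ (f a) c) (δ (f b) a) (δ (f b) c) (δ (f c) a) (δ (f c) b))
      (cong₂ _+_ (cong (λ d → δ (f a) b * D a b c + δ (f a) c * d) (swap₂₃ D-symmetric a b c))
        (cong₂ _+_ (cong₂ (λ d d′ → δ (f b) a * d + δ (f b) c * d′)
                     (swap₁₂ D-symmetric a b c) (rotate D-symmetric a b c))
                   (cong₂ (λ d d′ → δ (f c) a * d + δ (f c) b * d′) (sym (rotate D-symmetric c a b))
                      (trans (rotate D-symmetric a b c) (swap₁₂ D-symmetric b c a)))))
    -- The arc from `a` to `f a` lies in `n ∸ 2` of the 3-sets, one for each further vertex.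
    ∑³-K : ∑³ K ≡ N
    ∑³-K = begin
      ∑³ K
        ≡⟨ ∑³-δ-D f ⟩
      ∑[ a < n ] sum (D a (f a))
        ≡⟨ sum-cong-≗ (λ a → ∑-D∸ (≢-sym (f-irrefl a))) ⟩
      ∑[ a < n ] (n ∸ 2)
        ≡⟨ ∑-const n (n ∸ 2) ⟩
      N ∎

  parity : Triple n
  parity a b c = arcs a b c % 2

  parity-symmetric : Symmetric₃ parity
  parity-symmetric .swap₁₂ a b c = cong (_% 2) (swap₁₂ arcs-symmetric a b c)
  parity-symmetric .swap₂₃ a b c = cong (_% 2) (swap₂₃ arcs-symmetric a b c)
  parity-symmetric .diag a c = cong (_% 2) (diag arcs-symmetric a c)

  arcs-distinct : ∀ {a b c} → Distinct a b c → arcs a b c ≡ out a b c + out b a c + out c a b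
  arcs-distinct {a} {b} {c} abc =
    trans (cong (_* (out a b c + out b a c + out c a b)) (D-distinct abc)) (*-identityˡ _)

  -- An arc inside the 4-set lies in exactly two of its four 3-sets, so every arc is counted twice.
  four-even : ∀ {a b c d} → Distinct a b c → d ≢ a → d ≢ b → d ≢ c →
              2 ∣ arcs a b c + (arcs d a b + (arcs d a c + arcs d b c))
  four-even {a} {b} {c} {d} abc@(a≢b , a≢c , b≢c) d≢a d≢b d≢c = subst (2 ∣_) (sym (trans
      (cong₂ _+_ (arcs-distinct abc) (cong₂ _+_ (arcs-distinct (d≢a , d≢b , a≢b))
        (cong₂ _+_ (arcs-distinct (d≢a , d≢c , a≢c)) (arcs-distinct (d≢b , d≢c , b≢c)))))
      (collect (δ (f a) b) (δ (f a) c) (δ (f a) d) (δ (f b) a) (δ (f b) c) (δ (f b) d)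
               (δ (f c) a) (δ (f c) b) (δ (f c) d) (δ (f d) a) (δ (f d) b) (δ (f d) c))))
      (m∣m*n (out a b c + δ (f a) d + (out b a c + δ (f b) d) + (out c a b + δ (f c) d) + (out d a b + δ (f d) c)))
    where
    collect : ∀ ab ac ad ba bc bd ca cb cd da db dc →
      (ab + ac) + (ba + bc) + (ca + cb) +
      ((da + db) + (ad + ab) + (bd + ba) +
      ((da + dc) + (ad + ac) + (cd + ca) +
      ((db + dc) + (bd + bc) + (cd + cb))))
      ≡ 2 * (ab + ac + ad + (ba + bc + bd) + (ca + cb + cd) + (da + db + dc))
    collect = solve-∀

  module _ {a b c : Fin n} (abc : Distinct a b c) (odd : parity a b c ≡ 1) where

    -- For `d` outside the set this follows from `four-even`; for `d` inside, one summand is the odd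
    -- 3-set itself. The sum over all `d` is at least `n` and counts `{a , b , c}` three times,
    -- which leaves at least `n − 2` different odd 3-sets.
    odd-neighbour : ∀ d → 1 ≤ parity d a b + (parity d a c + parity d b c)
    odd-neighbour d = go (d ≟ a) (d ≟ b) (d ≟ c)
      where
      go : Dec (d ≡ a) → Dec (d ≡ b) → Dec (d ≡ c) → 1 ≤ parity d a b + (parity d a c + parity d b c)
      go (yes refl) _ _ = ≤-trans (≤-reflexive (sym odd))
        (≤-trans (m≤n+m (parity a b c) (parity a a c)) (m≤n+m _ (parity a a b)))
      go (no _) (yes refl) _ = ≤-trans (≤-reflexive (trans (sym odd) (swap₁₂ parity-symmetric a b c)))
        (≤-trans (m≤m+n (parity b a c) (parity b b c)) (m≤n+m _ (parity b a b)))
      go (no _) (no _) (yes refl) = ≤-trans (≤-reflexive (trans (sym odd) (sym (rotate parity-symmetric c a b))))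
        (m≤m+n (parity c a b) _)
      go (no d≢a) (no d≢b) (no d≢c) =
        odd-summand (arcs a b c) (arcs d a b) (arcs d a c) (arcs d b c) odd (four-even abc d≢a d≢b d≢c)

    -- On triples of distinct vertices, χ-pairs − 2 χ³ is the indicator of
    -- meeting {a , b , c} in at least two vertices; at least n − 2 unordered
    -- triples of this kind are odd.  It is split over both sides to avoid ∸.
    odd-triples-bound : (g ξ κ : Triple n) →
      (∀ x y z → 2 * g x y z + ξ x y z + χ-pairs a b c x y z * parity x y z
                 ≤ arcs x y z + 2 * (χ³ a b c x y z * parity x y z) + κ x y z) →
      2 * ∑³ g + ∑³ ξ + 6 * n ≤ 6 * (n * (n ∸ 2)) + 12 + ∑³ κ
    odd-triples-bound g ξ κ pointwise = begin
      2 * ∑³ g + ∑³ ξ + 6 * n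
        ≤⟨ +-monoʳ-≤ (2 * ∑³ g + ∑³ ξ) (*-monoʳ-≤ 6 
             (≤-trans (≤-reflexive (sym (∑-one n))) (∑-mono odd-neighbour))) ⟩
      2 * ∑³ g + ∑³ ξ + 6 * ∑[ z < n ] (parity z a b + (parity z a c + parity z b c))
        ≡⟨ cong₂ _+_ (cong (_+ ∑³ ξ) (∑³-*ˡ 2 g)) (∑³-χ-pairs a b c abc parity-symmetric) ⟨
      ∑³ (λ x y z → 2 * g x y z) + ∑³ ξ + ∑³ P
        ≡⟨ trans (∑³-+ (λ x y z → 2 * g x y z + ξ x y z) P) (cong (_+ ∑³ P) (∑³-+ (λ x y z → 2 * g x y z) ξ)) ⟨
      ∑³ (λ x y z → 2 * g x y z + ξ x y z + P x y z)
        ≤⟨ ∑³-mono pointwise ⟩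
      ∑³ (λ x y z → arcs x y z + 2 * Q x y z + κ x y z)
        ≡⟨ trans (∑³-+ (λ x y z → arcs x y z + 2 * Q x y z) κ)
                 (cong (_+ ∑³ κ) (∑³-+ arcs (λ x y z → 2 * Q x y z))) ⟩
      ∑³ arcs + ∑³ (λ x y z → 2 * Q x y z) + ∑³ κ
        ≡⟨ cong (_+ ∑³ κ) (cong₂ _+_ ∑³-arcs
             (trans (∑³-*ˡ 2 Q) (cong (2 *_) (trans (∑³-χ³ a b c abc parity-symmetric) (cong (6 *_) odd))))) ⟩
      6 * (n * (n ∸ 2)) + 12 + ∑³ κ ∎
      where
      open ≤-Reasoning
      P Q : Triple n
      P x y z = χ-pairs a b c x y z * parity x y z
      Q x y z = χ³ a b c x y z * parity x y z

  -- If every 3-set is even, `arcs` is twice a symmetric function, whose sum is divisible by 6. So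
  -- 12 divides `6 * (n * (n ∸ 2))`.
  odd-triple : (∃ λ a → ∃ λ b → ∃ λ c → parity a b c ≡ 1) ⊎ 2 ∣ n * (n ∸ 2)
  odd-triple with any? (λ a → any? λ b → any? λ c → parity a b c ≟ℕ 1)
  ... | yes found = inj₁ found
  ... | no none = inj₂ (*-cancelˡ-∣ 6 (subst (12 ∣_) 2∑half≡ (*-monoʳ-∣ 2 (6∣∑³ n half half-symmetric))))
    where
    half : Triple n
    half a b c = arcs a b c / 2
    half-symmetric : Symmetric₃ half
    half-symmetric .swap₁₂ a b c = cong (_/ 2) (swap₁₂ arcs-symmetric a b c)
    half-symmetric .swap₂₃ a b c = cong (_/ 2) (swap₂₃ arcs-symmetric a b c)
    half-symmetric .diag a c = cong (_/ 2) (diag arcs-symmetric a c)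
    halve : ∀ a b c → arcs a b c ≡ 2 * half a b c
    halve a b c with m%2≡0∨1 (arcs a b c)
    ... | inj₁ eq = m%2≡0⇒even (arcs a b c) eq
    ... | inj₂ eq = contradiction (a , b , c , eq) none
    2∑half≡ : 2 * ∑³ half ≡ 6 * (n * (n ∸ 2))
    2∑half≡ = trans (sym (trans (∑³-cong halve) (∑³-*ˡ 2 half))) ∑³-arcs

-- Links and degrees.

module _ {n : ℕ} (H : Graph n) where

  edges : Triple n
  edges a b c = ⟦ edge? H a b c ⟧

  edges-comm : ∀ a b c → edges a b c ≡ edges b a c
  edges-comm a b c = ⟦⟧-cong (edge? H a b c) (edge? H b a c) (tail-sym H) (tail-sym H)

  edges-diag : ∀ a c → edges a a c ≡ 0
  edges-diag a c = ⟦⟧-no (edge? H a a c) λ e → proj₁ (distinct H e) refl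

  -- `size` sees an edge at the increasing ordering of its tail only, `edges` at both orderings.
  2*size≡∑³ : 2 * size H ≡ ∑³ edges
  2*size≡∑³ = begin
    2 * size H                              ≡⟨ cong (∑³ low +_) (+-identityʳ (∑³ low)) ⟩
    ∑³ low + ∑³ low                         ≡⟨ cong (∑³ low +_) (∑³-swap₁₂ low) ⟨
    ∑³ low + ∑³ (λ a b c → low b a c)       ≡⟨ ∑³-+ low (λ a b c → low b a c) ⟨
    ∑³ (λ a b c → low a b c + low b a c)    ≡⟨ ∑³-cong split ⟩
    ∑³ edges                                ∎
    where
    open ≡-Reasoning
    low : Triple n
    low a b c = ⟦ (a <? b) ×-dec edge? H a b c ⟧
    split : ∀ a b c → low a b c + low b a c ≡ edges a b c
    split a b c with <-cmp a b
    ... | tri< a<b _ b≮a = trans (cong₂ _+_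
            (⟦⟧-cong ((a <? b) ×-dec edge? H a b c) (edge? H a b c) proj₂ (a<b ,_))
            (⟦⟧-no ((b <? a) ×-dec edge? H b a c) (b≮a ∘ proj₁))) (+-identityʳ _)
    ... | tri≈ a≮b refl _ = trans (cong₂ _+_ z z) (sym (edges-diag a c))
      where z = ⟦⟧-no ((a <? a) ×-dec edge? H a a c) (a≮b ∘ proj₁)
    ... | tri> a≮b _ b<a = cong₂ _+_
            (⟦⟧-no ((a <? b) ×-dec edge? H a b c) (a≮b ∘ proj₁))
            (⟦⟧-cong ((b <? a) ×-dec edge? H b a c) (edge? H a b c)
                     (tail-sym H ∘ proj₂) (λ e → b<a , tail-sym H e))

  -- The link digraph of `x`, whose arc `b → c` is the edge `xb → c`, with directions forgotten.
  Link : Fin n → Fin n → Fin n → Set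
  Link x b c = Edge H x b c ⊎ Edge H x c b

  Link-sym : ∀ {x b c} → Link x b c → Link x c b
  Link-sym (inj₁ e) = inj₂ e
  Link-sym (inj₂ e) = inj₁ e

  Link-irrefl : ∀ {x b c} → Link x b c → b ≢ c
  Link-irrefl (inj₁ e) = proj₂ (proj₂ (distinct H e))
  Link-irrefl (inj₂ e) = ≢-sym (proj₂ (proj₂ (distinct H e)))

  Link-≢ : ∀ {x b c} → Link x b c → b ≢ x
  Link-≢ (inj₁ e) = ≢-sym (proj₁ (distinct H e))
  Link-≢ (inj₂ e) = ≢-sym (proj₁ (proj₂ (distinct H e)))

  -- An empty link counts as a star around any `y ≢ x`. The first component makes a choice of
  -- centres irreflexive.
  Star : Fin n → Fin n → Set
  Star x y = y ≢ x × (∀ b c → Edge H x b c → b ≡ y ⊎ c ≡ y)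

  star? : ∀ x → Dec (∃ (Star x))
  star? x = any? λ y → ¬? (y ≟ x) ×-dec all? λ b → all? λ c → edge? H x b c →-dec (b ≟ y ⊎-dec c ≟ y)

  record Triangle (x : Fin n) : Set where
    field
      {p q r} : Fin n
      pqr     : Distinct p q r
      p≢x     : p ≢ x
      q≢x     : q ≢ x
      r≢x     : r ≢ x
      inside  : ∀ {b c} → Link x b c → b ≡ p ⊎ b ≡ q ⊎ b ≡ r

  degree : Fin n → ℕ
  degree x = ∑[ b < n ] ∑[ c < n ] edges x b c

  module _ (oriented : Oriented H) where

    -- The edges `xb → c` and `xc → b` share a 3-set, so an oriented graph has at most one of them.
    both-heads≤D : ∀ x b c → edges x b c + edges x c b ≤ D x b c
    both-heads≤D x b c with edge? H x b c | edge? H x c b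
    ... | yes e | yes e′ = contradiction e′ (proj₁ (oriented x b c e))
    ... | yes e | no _   = ≤-reflexive (sym (D-distinct (distinct H e)))
    ... | no _  | yes e  = ≤-reflexive (sym (D-distinct (Distinct-swap₂₃ (distinct H e))))
    ... | no _  | no _   = z≤n

    -- Every arc of the link joins `y` to some `c` other than `x` and `y`, in one direction only.
    degree-star : ∀ {x y} → Star x y → degree x ≤ n ∸ 2
    degree-star {x} {y} (_ , star) = begin
      degree x
        ≤⟨ (∑-mono λ b → ∑-mono λ c → pointwise b c) ⟩
      ∑[ b < n ] ∑[ c < n ] (δ y b * edges x b c + δ y c * edges x b c)
        ≡⟨ sum-cong-≗ (λ b → trans (∑-distrib-+ (λ c → δ y b * edges x b c) (λ c → δ y c * edges x b c))
             (cong₂ _+_ (∑-*ˡ (δ y b) (edges x b)) (∑-δ y (edges x b)))) ⟩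
      ∑[ b < n ] (δ y b * sum (edges x b) + edges x b y)
        ≡⟨ trans (∑-distrib-+ (λ b → δ y b * sum (edges x b)) (λ b → edges x b y))
             (cong (_+ ∑[ b < n ] edges x b y) (∑-δ y (λ b → sum (edges x b)))) ⟩
      ∑[ c < n ] edges x y c + ∑[ c < n ] edges x c y
        ≡⟨ ∑-distrib-+ (edges x y) (λ c → edges x c y) ⟨
      ∑[ c < n ] (edges x y c + edges x c y)
        ≤⟨ ∑-mono (both-heads≤D x y) ⟩
      ∑[ c < n ] D x y c
        ≤⟨ ∑-D≤ x y ⟩
      n ∸ 2 ∎
      where
      open ≤-Reasoning
      pointwise : ∀ b c → edges x b c ≤ δ y b * edges x b c + δ y c * edges x b c
      pointwise b c = go (edge? H x b c)
        where
        weight : ∀ v → δ v v * edges x b c ≡ edges x b c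
        weight v = trans (cong (_* edges x b c) (⟦⟧-yes (v ≟ v) refl)) (*-identityˡ _)
        go : Dec (Edge H x b c) → edges x b c ≤ δ y b * edges x b c + δ y c * edges x b c
        go (no ¬e) = ≤-trans (≤-reflexive (⟦⟧-no (edge? H x b c) ¬e)) z≤n
        go (yes e) with star b c e
        ... | inj₁ refl = ≤-trans (≤-reflexive (sym (weight b))) (m≤m+n _ _)
        ... | inj₂ refl = ≤-trans (≤-reflexive (sym (weight c))) (m≤n+m _ (δ c b * edges x b c))

    -- Each of the three pairs in `{p , q , r}` carries at most one arc. The degree is doubled so
    -- that the summand becomes symmetric and `∑²-χ` applies.
    degree-triangle : ∀ {x} → Triangle x → degree x ≤ 3
    degree-triangle {x} T = *-cancelˡ-≤ 2 (begin
      2 * degree x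
        ≡⟨ cong (degree x +_) (+-identityʳ _) ⟩
      degree x + degree x
        ≡⟨ cong (degree x +_) (∑-comm (edges x)) ⟩
      degree x + ∑[ b < n ] ∑[ c < n ] edges x c b
        ≡⟨ trans (sum-cong-≗ λ b → ∑-distrib-+ (edges x b) (λ c → edges x c b))
                 (∑-distrib-+ (λ b → sum (edges x b)) (λ b → ∑[ c < n ] edges x c b)) ⟨
      ∑[ b < n ] ∑[ c < n ] G b c
        ≡⟨ sum-cong-≗ (λ b → sum-cong-≗ λ c → supported b c) ⟩
      ∑[ b < n ] ∑[ c < n ] (χ p q r b * (χ p q r c * G b c))
        ≡⟨ ∑²-χ p q r pqr G (λ b c → +-comm (edges x b c) (edges x c b)) (λ b → cong₂ _+_ (loop b) (loop b)) ⟩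
      2 * (G p q + (G p r + G q r))
        ≤⟨ *-monoʳ-≤ 2 (+-mono-≤ (G≤1 p q) (+-mono-≤ (G≤1 p r) (G≤1 q r))) ⟩
      2 * 3 ∎)
      where
      open ≤-Reasoning
      open Triangle T
      G : Fin n → Fin n → ℕ
      G b c = edges x b c + edges x c b
      loop : ∀ b → edges x b b ≡ 0
      loop b = ⟦⟧-no (edge? H x b b) λ e → proj₂ (proj₂ (distinct H e)) refl
      G≤1 : ∀ b c → G b c ≤ 1
      G≤1 b c = ≤-trans (both-heads≤D x b c) (⟦⟧≤1 (distinct? x b c))
      χ-link : ∀ {b c} → Link x b c → χ p q r b ≡ 1
      χ-link {b} l = ⟦⟧-yes (member? p q r b) (inside l)
      supported : ∀ b c → G b c ≡ χ p q r b * (χ p q r c * G b c)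
      supported b c = go (edge? H x b c ⊎-dec edge? H x c b)
        where
        go : Dec (Link x b c) → G b c ≡ χ p q r b * (χ p q r c * G b c)
        go (yes l) = sym (trans (cong₂ (λ u v → u * (v * G b c)) (χ-link l) (χ-link (Link-sym l)))
                                (trans (*-identityˡ _) (*-identityˡ _)))
        go (no ¬l) = trans G≡0 (sym (trans (cong (λ g → χ p q r b * (χ p q r c * g)) G≡0)
                       (trans (cong (χ p q r b *_) (*-zeroʳ (χ p q r c))) (*-zeroʳ (χ p q r b)))))
          where
          G≡0 : G b c ≡ 0
          G≡0 = cong₂ _+_ (⟦⟧-no (edge? H x b c) (¬l ∘ inj₁)) (⟦⟧-no (edge? H x c b) (¬l ∘ inj₂))

  -- Without `H₁`, a link is a star or lies in a triangle.

  module _ (free : (H₁ Free) H) where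

    -- If all four equalities fail, the five vertices are distinct and the two edges form a copy of
    -- `H₁`.
    Edges-meet : ∀ {x a b c d} → Edge H a x b → Edge H c x d → a ≡ c ⊎ a ≡ d ⊎ b ≡ c ⊎ b ≡ d
    Edges-meet {x} {a} {b} {c} {d} e e′ with a ≟ c | a ≟ d | b ≟ c | b ≟ d
    ... | yes p | _ | _ | _ = inj₁ p
    ... | no _ | yes p | _ | _ = inj₂ (inj₁ p)
    ... | no _ | no _ | yes p | _ = inj₂ (inj₂ (inj₁ p))
    ... | no _ | no _ | no _ | yes p = inj₂ (inj₂ (inj₂ p))
    ... | no a≢c | no a≢d | no b≢c | no b≢d =
      contradiction (lookup vs , (λ {i} {j} → lookup-injective unique i j) , embed) free
      where
      -- The order follows the numbering of the vertices of `H₁`, with `x` last.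
      vs = a ∷ b ∷ c ∷ d ∷ x ∷ []
      unique : AllPairs _≢_ vs
      unique = (proj₁ (proj₂ (distinct H e)) ∷ a≢c ∷ a≢d ∷ proj₁ (distinct H e) ∷ [])
             ∷ (b≢c ∷ b≢d ∷ ≢-sym (proj₂ (proj₂ (distinct H e))) ∷ [])
             ∷ (proj₁ (proj₂ (distinct H e′)) ∷ proj₁ (distinct H e′) ∷ [])
             ∷ (≢-sym (proj₂ (proj₂ (distinct H e′))) ∷ [])
             ∷ [] ∷ []
      embed : ∀ i j k → Edge H₁ i j k → Edge H (lookup vs i) (lookup vs j) (lookup vs k)
      embed _ _ _ (here refl) = e
      embed _ _ _ (there (here refl)) = tail-sym H e
      embed _ _ _ (there (there (here refl))) = e′
      embed _ _ _ (there (there (there (here refl)))) = tail-sym H e′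

    Edge-meets-Link : ∀ {x a b c d} → Edge H x a b → Link x c d → a ≡ c ⊎ a ≡ d ⊎ b ≡ c ⊎ b ≡ d
    Edge-meets-Link e (inj₁ e′) = Edges-meet (tail-sym H e) (tail-sym H e′)
    Edge-meets-Link e (inj₂ e′) with Edges-meet (tail-sym H e) (tail-sym H e′)
    ... | inj₁ a≡d               = inj₂ (inj₁ a≡d)
    ... | inj₂ (inj₁ a≡c)        = inj₁ a≡c
    ... | inj₂ (inj₂ (inj₁ b≡d)) = inj₂ (inj₂ (inj₂ b≡d))
    ... | inj₂ (inj₂ (inj₂ b≡c)) = inj₂ (inj₂ (inj₁ b≡c))

    Links-meet : ∀ {x a b c d} → Link x a b → Link x c d → a ≡ c ⊎ a ≡ d ⊎ b ≡ c ⊎ b ≡ d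
    Links-meet (inj₁ e) l = Edge-meets-Link e l
    Links-meet (inj₂ e) l with Edge-meets-Link e l
    ... | inj₁ b≡c               = inj₂ (inj₂ (inj₁ b≡c))
    ... | inj₂ (inj₁ b≡d)        = inj₂ (inj₂ (inj₂ b≡d))
    ... | inj₂ (inj₂ (inj₁ a≡c)) = inj₁ a≡c
    ... | inj₂ (inj₂ (inj₂ a≡d)) = inj₂ (inj₁ a≡d)

    star-or-avoided : ∀ {x y} → y ≢ x → Star x y ⊎ (∃ λ b → ∃ λ c → Link x b c × b ≢ y × c ≢ y)
    star-or-avoided {x} {y} y≢x with any? (λ b → any? λ c → edge? H x b c ×-dec ¬? (b ≟ y) ×-dec ¬? (c ≟ y))
    ... | yes (b , c , e , b≢y , c≢y) = inj₂ (b , c , inj₁ e , b≢y , c≢y)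
    ... | no none = inj₁ (y≢x , centre)
      where
      centre : ∀ b c → Edge H x b c → b ≡ y ⊎ c ≡ y
      centre b c e with b ≟ y | c ≟ y
      ... | yes p | _ = inj₁ p
      ... | no _ | yes p = inj₂ p
      ... | no b≢y | no c≢y = contradiction (b , c , e , b≢y , c≢y) none

    -- As `y` is no centre, some arc avoids it. That arc must still meet the arc between `y` and
    -- `z`, hence contains `z`.
    avoided-neighbour : ∀ {x y z} → Link x y z → ¬ ∃ (Star x) → ∃ λ w → Link x z w × w ≢ y
    avoided-neighbour {x} {y} {z} l ¬star with star-or-avoided (Link-≢ l)
    ... | inj₁ s = contradiction (y , s) ¬star
    ... | inj₂ (b , c , l′ , b≢y , c≢y) with Links-meet l l′
    ... | inj₁ y≡b = contradiction (sym y≡b) b≢y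
    ... | inj₂ (inj₁ y≡c) = contradiction (sym y≡c) c≢y
    ... | inj₂ (inj₂ (inj₁ refl)) = c , l′ , c≢y
    ... | inj₂ (inj₂ (inj₂ refl)) = b , Link-sym l′ , b≢y

    -- As `z` is no centre, there is some arc `pq`. Neither `p` nor `q` is a centre, which gives
    -- arcs `qr` and `ps`; these have to meet, so `r` is `s`. An arc with an end outside
    -- `{p , q , r}` would have to meet all three sides of the triangle in its other end.
    triangle : ∀ {x z} → z ≢ x → ¬ ∃ (Star x) → Triangle x
    triangle {x} {z} z≢x ¬star with star-or-avoided z≢x
    ... | inj₁ s = contradiction (z , s) ¬star
    ... | inj₂ (p , q , pq , _) with avoided-neighbour pq ¬star | avoided-neighbour (Link-sym pq) ¬star
    ... | r , qr , r≢p | s , ps , s≢q with Links-meet ps qr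
    ... | inj₁ p≡q = contradiction p≡q (Link-irrefl pq)
    ... | inj₂ (inj₁ p≡r) = contradiction (sym p≡r) r≢p
    ... | inj₂ (inj₂ (inj₁ s≡q)) = contradiction s≡q s≢q
    ... | inj₂ (inj₂ (inj₂ refl)) = record
      { pqr = p≢q , ≢-sym r≢p , q≢r
      ; p≢x = Link-≢ pq ; q≢x = Link-≢ qr ; r≢x = Link-≢ (Link-sym qr)
      ; inside = inside }
      where
      p≢q = Link-irrefl pq
      q≢r = Link-irrefl qr
      meets : ∀ {u v b c} → b ≢ u → b ≢ v → Link x u v → Link x b c → c ≡ u ⊎ c ≡ v
      meets b≢u b≢v uv bc with Links-meet bc uv
      ... | inj₁ p = contradiction p b≢u
      ... | inj₂ (inj₁ p) = contradiction p b≢v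
      ... | inj₂ (inj₂ p) = p
      inside : ∀ {b c} → Link x b c → b ≡ p ⊎ b ≡ q ⊎ b ≡ r
      inside {b} {c} bc with b ≟ p | b ≟ q | b ≟ r
      ... | yes eq | _ | _ = inj₁ eq
      ... | no _ | yes eq | _ = inj₂ (inj₁ eq)
      ... | no _ | no _ | yes eq = inj₂ (inj₂ eq)
      ... | no b≢p | no b≢q | no b≢r with meets b≢p b≢q pq bc
      ... | inj₁ refl = contradiction (meets b≢q b≢r qr bc) [ p≢q , ≢-sym r≢p ]′
      ... | inj₂ refl = contradiction (meets b≢p b≢r ps bc) [ ≢-sym p≢q , q≢r ]′

-- Auxiliary estimates.

⟦⟧-pairs-bound : ∀ {P Q R : Set} (p : Dec P) (q : Dec Q) (r : Dec R) k →
  (⟦ p ⟧ * ⟦ q ⟧ + ⟦ p ⟧ * ⟦ r ⟧ + ⟦ q ⟧ * ⟦ r ⟧) * k ≤ k + 2 * (⟦ p ⟧ * (⟦ q ⟧ * ⟦ r ⟧) * k)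
⟦⟧-pairs-bound (yes _) (yes _) (yes _) k = ≤-reflexive (solve k)
  where solve : ∀ k → 3 * k ≡ k + 2 * (1 * k)
        solve = solve-∀
⟦⟧-pairs-bound (yes _) (yes _) (no _)  _ = ≤-refl
⟦⟧-pairs-bound (yes _) (no _)  (yes _) _ = ≤-refl
⟦⟧-pairs-bound (no _)  (yes _) (yes _) _ = ≤-refl
⟦⟧-pairs-bound (yes _) (no _)  (no _)  _ = z≤n
⟦⟧-pairs-bound (no _)  (yes _) (no _)  _ = z≤n
⟦⟧-pairs-bound (no _)  (no _)  (yes _) _ = z≤n
⟦⟧-pairs-bound (no _)  (no _)  (no _)  _ = z≤n

⟦⟧-product≡0 : ∀ {P Q R : Set} (p : Dec P) (q : Dec Q) (r : Dec R) → ¬ (P × Q × R) → ⟦ p ⟧ * (⟦ q ⟧ * ⟦ r ⟧) ≡ 0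
⟦⟧-product≡0 (no _)  _       _       _    = refl
⟦⟧-product≡0 (yes _) (no _)  _       _    = refl
⟦⟧-product≡0 (yes _) (yes _) (no _)  _    = refl
⟦⟧-product≡0 (yes p) (yes q) (yes r) ¬pqr = contradiction (p , q , r) ¬pqr

module _ {n : ℕ} (a b c x y z : Fin n) where

  χ-pairs-bound : ∀ k → χ-pairs a b c x y z * k ≤ k + 2 * (χ³ a b c x y z * k)
  χ-pairs-bound = ⟦⟧-pairs-bound (member? a b c x) (member? a b c y) (member? a b c z)

  χ³≡0 : ¬ (Member a b c x × Member a b c y × Member a b c z) → χ³ a b c x y z ≡ 0
  χ³≡0 = ⟦⟧-product≡0 (member? a b c x) (member? a b c y) (member? a b c z)

  χ³≡1 : Member a b c x → Member a b c y → Member a b c z → χ³ a b c x y z ≡ 1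
  χ³≡1 x∈ y∈ z∈ = cong₂ _*_ (⟦⟧-yes (member? a b c x) x∈)
    (cong₂ _*_ (⟦⟧-yes (member? a b c y) y∈) (⟦⟧-yes (member? a b c z) z∈))

2+m%2≤m : ∀ {m} → 2 ≤ m → 2 + m % 2 ≤ m
2+m%2≤m {suc (suc m)} _ = s≤s (s≤s (m%n≤m m 2))
2+m%2≤m {suc zero} (s≤s ())

-- If every vertex were among the four, summing their indicators over all vertices would give
-- `n ≤ 4`.
fresh : ∀ {n} → 4 < n → (a b c d : Fin n) → ∃ λ y → y ≢ a × y ≢ b × y ≢ c × y ≢ d
fresh {n} 4<n a b c d with any? (λ y → ¬? (y ≟ a) ×-dec ¬? (y ≟ b) ×-dec ¬? (y ≟ c) ×-dec ¬? (y ≟ d))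
... | yes found = found
... | no none = contradiction 4<n (≤⇒≯ (begin
    n                          ≡⟨ ∑-one n ⟨
    ∑[ y < n ] 1               ≤⟨ ∑-mono covered ⟩
    ∑[ y < n ] (δ a y + (δ b y + (δ c y + δ d y)))
      ≡⟨ trans (∑-distrib-+ (δ a) (λ y → δ b y + (δ c y + δ d y))) (cong₂ _+_ (∑-δ₁ a)
           (trans (∑-distrib-+ (δ b) (λ y → δ c y + δ d y)) (cong₂ _+_ (∑-δ₁ b)
             (trans (∑-distrib-+ (δ c) (δ d)) (cong₂ _+_ (∑-δ₁ c) (∑-δ₁ d)))))) ⟩
    4 ∎))
  where
  open ≤-Reasoning
  covered : ∀ y → 1 ≤ δ a y + (δ b y + (δ c y + δ d y))
  covered y with a ≟ y | b ≟ y | c ≟ y | d ≟ y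
  ... | yes _ | _ | _ | _ = s≤s z≤n
  ... | no _ | yes _ | _ | _ = s≤s z≤n
  ... | no _ | no _ | yes _ | _ = s≤s z≤n
  ... | no _ | no _ | no _ | yes _ = s≤s z≤n
  ... | no p | no q | no r | no s = contradiction (y , ≢-sym p , ≢-sym q , ≢-sym r , ≢-sym s) none

-- Edges counted by their 3-sets.

module _ {n : ℕ} (H : Graph n) (oriented : Oriented H) where

  Edge₃ : Fin n → Fin n → Fin n → Set
  Edge₃ a b c = Edge H a b c ⊎ Edge H a c b ⊎ Edge H b c a

  Edge₃-swap₁₂ : ∀ {a b c} → Edge₃ a b c → Edge₃ b a c
  Edge₃-swap₁₂ (inj₁ e)        = inj₁ (tail-sym H e)
  Edge₃-swap₁₂ (inj₂ (inj₁ e)) = inj₂ (inj₂ e)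
  Edge₃-swap₁₂ (inj₂ (inj₂ e)) = inj₂ (inj₁ e)

  Edge₃-swap₂₃ : ∀ {a b c} → Edge₃ a b c → Edge₃ a c b
  Edge₃-swap₂₃ (inj₁ e)        = inj₂ (inj₁ e)
  Edge₃-swap₂₃ (inj₂ (inj₁ e)) = inj₁ e
  Edge₃-swap₂₃ (inj₂ (inj₂ e)) = inj₂ (inj₂ (tail-sym H e))

  edges₃ : Triple n
  edges₃ a b c = edges H a b c + (edges H a c b + edges H b c a)

  edges₃-symmetric : Symmetric₃ edges₃
  edges₃-symmetric .swap₁₂ a b c = cong₂ _+_ (edges-comm H a b c) (+-comm (edges H a c b) _)
  edges₃-symmetric .swap₂₃ a b c = trans (rearrange (edges H a b c) (edges H a c b) (edges H b c a))
    (cong (λ k → edges H a c b + (edges H a b c + k)) (edges-comm H b c a))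
    where
    rearrange : ∀ u v w → u + (v + w) ≡ v + (u + w)
    rearrange = solve-∀
  edges₃-symmetric .diag a c = cong₂ _+_ (edges-diag H a c) (cong₂ _+_ z z)
    where z = ⟦⟧-no (edge? H a c a) λ e → proj₁ (proj₂ (distinct H e)) refl

  ∑³-edges₃ : ∑³ edges₃ ≡ 6 * size H
  ∑³-edges₃ = begin
    ∑³ edges₃
      ≡⟨ ∑³-+ (edges H) (λ a b c → edges H a c b + edges H b c a) ⟩
    ∑³ (edges H) + ∑³ (λ a b c → edges H a c b + edges H b c a)
      ≡⟨ cong (∑³ (edges H) +_) (∑³-+ (λ a b c → edges H a c b) (λ a b c → edges H b c a)) ⟩
    ∑³ (edges H) + (∑³ (λ a b c → edges H a c b) + ∑³ (λ a b c → edges H b c a))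
      ≡⟨ cong (∑³ (edges H) +_) (cong₂ _+_ (∑³-swap₂₃ (edges H)) (∑³-rotate (edges H))) ⟩
    ∑³ (edges H) + (∑³ (edges H) + ∑³ (edges H))
      ≡⟨ cong (λ k → k + (k + k)) (2*size≡∑³ H) ⟨
    2 * size H + (2 * size H + 2 * size H)
      ≡⟨ collect (size H) ⟩
    6 * size H ∎
    where
    open ≡-Reasoning
    collect : ∀ k → 2 * k + (2 * k + 2 * k) ≡ 6 * k
    collect = solve-∀

  edges₃-cases : ∀ a b c → edges₃ a b c ≡ 0 ⊎ (edges₃ a b c ≡ 1 × Edge₃ a b c)
  edges₃-cases a b c with edge? H a b c | edge? H a c b | edge? H b c a
  ... | no _ | no _ | no _ = inj₁ refl
  ... | yes e | no _ | no _ = inj₂ (refl , inj₁ e)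
  ... | no _ | yes e | no _ = inj₂ (refl , inj₂ (inj₁ e))
  ... | no _ | no _ | yes e = inj₂ (refl , inj₂ (inj₂ e))
  ... | yes e | yes e′ | _ = contradiction e′ (proj₁ (oriented a b c e))
  ... | yes e | _ | yes e′ = contradiction e′ (proj₂ (oriented a b c e))
  ... | _ | yes e | yes e′ = contradiction (tail-sym H e′) (proj₂ (oriented a c b e))

  -- Weighing edges against kept vertices.

  module StarCentres (f : Fin n → Fin n) (f-irrefl : ∀ a → f a ≢ a) where

    open FunctionalGraph f f-irrefl

    out≥1 : ∀ {a b c} → b ≡ f a ⊎ c ≡ f a → 1 ≤ out a b c
    out≥1 {a} {b} {c} (inj₁ eq) = ≤-trans (≤-reflexive (sym (⟦⟧-yes (f a ≟ b) (sym eq)))) (m≤m+n _ _)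
    out≥1 {a} {b} {c} (inj₂ eq) = ≤-trans (≤-reflexive (sym (⟦⟧-yes (f a ≟ c) (sym eq)))) (m≤n+m _ (δ (f a) b))

    out-star : ∀ {a b c} → Edge H a b c → Star H a (f a) → 1 ≤ out a b c
    out-star e (_ , star) = out≥1 (star _ _ e)

    arcs≥out+out : ∀ {a b c} → Distinct a b c → out a b c + out b a c ≤ arcs a b c
    arcs≥out+out {a} {b} {c} abc = ≤-trans (m≤m+n _ (out c a b)) (≤-reflexive (sym (arcs-distinct abc)))

    -- The record keeps `a`, `b`, `c` visible to unification, whereas the bare inequality would
    -- unfold.
    record Arcs≥2 (a b c : Fin n) : Set where
      constructor ⟨_⟩
      field
        2≤arcs : 2 ≤ arcs a b c

    open Arcs≥2

    Arcs≥2-swap₁₂ : ∀ {a b c} → Arcs≥2 a b c → Arcs≥2 b a c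
    Arcs≥2-swap₁₂ {a} {b} {c} ⟨ t ⟩ = ⟨ subst (2 ≤_) (swap₁₂ arcs-symmetric a b c) t ⟩

    Arcs≥2-swap₂₃ : ∀ {a b c} → Arcs≥2 a b c → Arcs≥2 a c b
    Arcs≥2-swap₂₃ {a} {b} {c} ⟨ t ⟩ = ⟨ subst (2 ≤_) (swap₂₃ arcs-symmetric a b c) t ⟩

    Covered : Fin n → Fin n → Fin n → Set
    Covered a b c = Edge₃ a b c → Arcs≥2 a b c

    two-outs : ∀ {a b c} → Edge H a b c → 1 ≤ out a b c → 1 ≤ out b a c → Arcs≥2 a b c
    two-outs e o o′ = ⟨ ≤-trans (+-mono-≤ o o′) (arcs≥out+out (distinct H e)) ⟩

    -- An edge pays with two kept vertices. An odd number of them leaves one over, with or without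
    -- an edge.
    covered-bound : ∀ a b c → Covered a b c → 2 * edges₃ a b c + parity a b c ≤ arcs a b c
    covered-bound a b c cov with edges₃-cases a b c
    ... | inj₁ eq = ≤-trans (≤-reflexive (cong (λ k → 2 * k + parity a b c) eq)) (m%n≤m (arcs a b c) 2)
    ... | inj₂ (eq , e) = ≤-trans (≤-reflexive (cong (λ k → 2 * k + parity a b c) eq)) (2+m%2≤m (2≤arcs (cov e)))

    Edge₃-elim : ∀ {P : Fin n → Fin n → Fin n → Set} →
      (∀ {a b c} → P a b c → P b a c) → (∀ {a b c} → P a b c → P a c b) →
      (∀ {a b c} → Edge H a b c → P a b c) → ∀ {a b c} → Edge₃ a b c → P a b c
    Edge₃-elim s₁ s₂ p (inj₁ e)        = p e
    Edge₃-elim s₁ s₂ p (inj₂ (inj₁ e)) = s₂ (p e)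
    Edge₃-elim s₁ s₂ p (inj₂ (inj₂ e)) = s₁ (s₂ (p e))

    -- `covered-bound` charges every odd 3-set one unit, and `odd-triples-bound` collects those
    -- meeting a fixed odd 3-set in at least two vertices. This yields the bound with 2 in place of
    -- 3; the weaker form is the one shared with the triangle cases.
    all-covered-bound : ¬ 2 ∣ n * (n ∸ 2) → (∀ a b c → Covered a b c) →
                        2 * size H + n ≤ n * (n ∸ 2) + 3
    all-covered-bound odd covered with odd-triple
    ... | inj₂ even = contradiction even odd
    ... | inj₁ (a , b , c , abc-odd) with Distinct-elim parity-symmetric a b c
    ... | inj₂ abc-even = contradiction (trans (sym abc-odd) abc-even) λ ()
    ... | inj₁ abc = *-cancelˡ-≤ 6 (begin
      6 * (2 * size H + n)
        ≡⟨ lhs (size H) n ⟩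
      2 * (6 * size H) + 0 + 6 * n
        ≡⟨ cong₂ (λ s z → 2 * s + z + 6 * n) ∑³-edges₃ ∑³0 ⟨
      2 * ∑³ edges₃ + ∑³ 𝟎 + 6 * n
        ≤⟨ odd-triples-bound abc abc-odd edges₃ 𝟎 𝟎 pointwise ⟩
      6 * (n * (n ∸ 2)) + 12 + ∑³ 𝟎
        ≡⟨ cong (6 * (n * (n ∸ 2)) + 12 +_) ∑³0 ⟩
      6 * (n * (n ∸ 2)) + 12 + 0
        ≤⟨ ≤-trans (m≤m+n _ 6) (≤-reflexive (rhs (n * (n ∸ 2)))) ⟩
      6 * (n * (n ∸ 2) + 3) ∎)
      where
      open ≤-Reasoning
      𝟎 : Triple n
      𝟎 _ _ _ = 0
      ∑³0 : ∑³ 𝟎 ≡ 0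
      ∑³0 = ∑-zero {n} λ _ → ∑-zero {n} λ _ → ∑-zero {n} λ _ → refl
      lhs : ∀ s k → 6 * (2 * s + k) ≡ 2 * (6 * s) + 0 + 6 * k
      lhs = solve-∀
      rhs : ∀ k → 6 * k + 12 + 0 + 6 ≡ 6 * (k + 3)
      rhs = solve-∀
      pointwise : ∀ x y z → 2 * edges₃ x y z + 0 + χ-pairs a b c x y z * parity x y z
                            ≤ arcs x y z + 2 * (χ³ a b c x y z * parity x y z) + 0
      pointwise x y z = begin
        2 * edges₃ x y z + 0 + χ-pairs a b c x y z * parity x y z
          ≡⟨ cong (_+ χ-pairs a b c x y z * parity x y z) (+-identityʳ _) ⟩
        2 * edges₃ x y z + χ-pairs a b c x y z * parity x y z
          ≤⟨ +-monoʳ-≤ (2 * edges₃ x y z) (χ-pairs-bound a b c x y z (parity x y z)) ⟩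
        2 * edges₃ x y z + (parity x y z + 2 * (χ³ a b c x y z * parity x y z))
          ≡⟨ +-assoc (2 * edges₃ x y z) _ _ ⟨
        2 * edges₃ x y z + parity x y z + 2 * (χ³ a b c x y z * parity x y z)
          ≤⟨ +-monoˡ-≤ _ (covered-bound x y z (covered x y z)) ⟩
        arcs x y z + 2 * (χ³ a b c x y z * parity x y z)
          ≡⟨ +-identityʳ _ ⟨
        arcs x y z + 2 * (χ³ a b c x y z * parity x y z) + 0 ∎

    all-stars-bound : ¬ 2 ∣ n * (n ∸ 2) → (∀ a → Star H a (f a)) → 2 * size H + n ≤ n * (n ∸ 2) + 3
    all-stars-bound odd stars = all-covered-bound odd λ a b c →
      Edge₃-elim Arcs≥2-swap₁₂ Arcs≥2-swap₂₃ λ {a} {b} e →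
        two-outs e (out-star e (stars a)) (out-star (tail-sym H e) (stars b))

    -- A single triangle link.

    module OneTriangle {x : Fin n} (T : Triangle H x) (fx≡p : f x ≡ Triangle.p T)
                       (stars : ∀ {z} → z ≢ x → Star H z (f z)) where

      open Triangle T

      p≢q = proj₁ pqr
      p≢r = proj₁ (proj₂ pqr)
      q≢r = proj₂ (proj₂ pqr)

      xqr : Distinct x q r
      xqr = ≢-sym q≢x , ≢-sym r≢x , q≢r

      _∈₀ : Fin n → Set
      _∈₀ = Member x q r

      CoveredOrInside : Fin n → Fin n → Fin n → Set
      CoveredOrInside a b c = Arcs≥2 a b c ⊎ (a ∈₀ × b ∈₀ × c ∈₀)

      -- The other tail vertex `b` has a star link and is kept. If `p` is among `b` and `c`, then
      -- `x` is kept as well, because `f x` is `p`; otherwise `b` and `c` lie in `{q , r}`.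
      edge-at-x : ∀ {b c} → Edge H x b c → CoveredOrInside x b c
      edge-at-x {b} {c} e = go (inside (inj₁ e)) (inside (inj₂ e))
        where
        both : 1 ≤ out x b c → Arcs≥2 x b c
        both 1≤out = two-outs e 1≤out (out-star (tail-sym H e) (stars (≢-sym (proj₁ (distinct H e)))))
        go : b ≡ p ⊎ b ≡ q ⊎ b ≡ r → c ≡ p ⊎ c ≡ q ⊎ c ≡ r → CoveredOrInside x b c
        go (inj₁ b≡p) _ = inj₁ (both (out≥1 (inj₁ (trans b≡p (sym fx≡p)))))
        go (inj₂ _) (inj₁ c≡p) = inj₁ (both (out≥1 (inj₂ (trans c≡p (sym fx≡p)))))
        go (inj₂ b∈) (inj₂ c∈) = inj₂ (inj₁ refl , inj₂ b∈ , inj₂ c∈)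

      CoveredOrInside-swap₁₂ : ∀ {a b c} → CoveredOrInside a b c → CoveredOrInside b a c
      CoveredOrInside-swap₁₂ (inj₁ t) = inj₁ (Arcs≥2-swap₁₂ t)
      CoveredOrInside-swap₁₂ (inj₂ (u , v , w)) = inj₂ (v , u , w)

      CoveredOrInside-swap₂₃ : ∀ {a b c} → CoveredOrInside a b c → CoveredOrInside a c b
      CoveredOrInside-swap₂₃ (inj₁ t) = inj₁ (Arcs≥2-swap₂₃ t)
      CoveredOrInside-swap₂₃ (inj₂ (u , v , w)) = inj₂ (u , w , v)

      covered-or-inside : ∀ {a b c} → Edge₃ a b c → CoveredOrInside a b c
      covered-or-inside = Edge₃-elim CoveredOrInside-swap₁₂ CoveredOrInside-swap₂₃
        λ {a} {b} e → go e (a ≟ x) (b ≟ x)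
        where
        go : ∀ {a b c} → Edge H a b c → Dec (a ≡ x) → Dec (b ≡ x) → CoveredOrInside a b c
        go e (yes refl) _ = edge-at-x e
        go e (no _) (yes refl) = CoveredOrInside-swap₁₂ (edge-at-x (tail-sym H e))
        go e (no a≢x) (no b≢x) = inj₁ (two-outs e (out-star e (stars a≢x)) (out-star (tail-sym H e) (stars b≢x)))

      covered-everywhere : Covered x q r → ∀ a b c → Covered a b c
      covered-everywhere cov a b c e with covered-or-inside e
      ... | inj₁ t = t
      ... | inj₂ (a∈ , b∈ , c∈) = permutation-elim x q r Covered
              (λ h → Arcs≥2-swap₁₂ ∘ h ∘ Edge₃-swap₁₂) (λ h → Arcs≥2-swap₂₃ ∘ h ∘ Edge₃-swap₂₃) cov
              (distinct₃ e) a∈ b∈ c∈ e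
        where
        distinct₃ : ∀ {a b c} → Edge₃ a b c → Distinct a b c
        distinct₃ = Edge₃-elim Distinct-swap₁₂ Distinct-swap₂₃ (distinct H)

      arcs≥1 : ∀ {a b c} → Edge H a b c → a ≢ x ⊎ b ≢ x → 1 ≤ arcs a b c
      arcs≥1 e (inj₁ a≢x) = ≤-trans (out-star e (stars a≢x)) (≤-trans (m≤m+n _ _) (arcs≥out+out (distinct H e)))
      arcs≥1 {a} {b} {c} e (inj₂ b≢x) =
        ≤-trans (out-star (tail-sym H e) (stars b≢x)) (≤-trans (m≤n+m _ (out a b c)) (arcs≥out+out (distinct H e)))

      -- Some tail vertex of the edge differs from `x`, so its link is a star and it is kept. Fewer
      -- than two kept vertices thus means exactly one.
      xqr-odd : Edge₃ x q r → ¬ 2 ≤ arcs x q r → parity x q r ≡ 1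
      xqr-odd e few = cong (_% 2) (≤-antisym (s≤s⁻¹ (≰⇒> few)) (positive e))
        where
        positive : Edge₃ x q r → 1 ≤ arcs x q r
        positive (inj₁ e) = arcs≥1 e (inj₂ q≢x)
        positive (inj₂ (inj₁ e)) = subst (1 ≤_) (swap₂₃ arcs-symmetric x r q) (arcs≥1 e (inj₂ r≢x))
        positive (inj₂ (inj₂ e)) = subst (1 ≤_) (sym (rotate arcs-symmetric x q r)) (arcs≥1 e (inj₁ q≢x))

      module _ {y : Fin n} (y≢x : y ≢ x) (y≢p : y ≢ p) (y≢q : y ≢ q) (y≢r : y ≢ r) where

        xpy : Distinct x p y
        xpy = ≢-sym p≢x , ≢-sym y≢x , ≢-sym y≢p

        y-outside : ∀ {b} → ¬ Link H x y b
        y-outside l = [ y≢p , [ y≢q , y≢r ]′ ]′ (inside l)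

        -- Since `y` is outside the link of `x`, the only possible edge is `py → x`. With it all
        -- three vertices are kept, as `p` and `y` have star links; without it `x` is still kept.
        xpy-wasteful : 2 * edges₃ x p y + 1 ≤ arcs x p y
        xpy-wasteful with edges₃-cases x p y
        ... | inj₁ eq = ≤-trans (≤-reflexive (cong (λ k → 2 * k + 1) eq))
                (≤-trans (out≥1 (inj₁ (sym fx≡p))) (≤-trans (m≤m+n _ (out p x y)) (arcs≥out+out xpy)))
        ... | inj₂ (_ , inj₁ e) = contradiction (inj₂ e) y-outside
        ... | inj₂ (_ , inj₂ (inj₁ e)) = contradiction (inj₁ e) y-outside
        ... | inj₂ (eq , inj₂ (inj₂ e)) = begin
          2 * edges₃ x p y + 1
            ≡⟨ cong (λ k → 2 * k + 1) eq ⟩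
          1 + 1 + 1
            ≤⟨ +-mono-≤ (+-mono-≤ (out≥1 (inj₁ (sym fx≡p))) (out-star e (stars p≢x)))
                        (out-star (tail-sym H e) (stars y≢x)) ⟩
          out x p y + out p y x + out y p x
            ≡⟨ cong₂ (λ u v → out x p y + u + v) (+-comm (δ (f p) y) _) (+-comm (δ (f y) p) _) ⟩
          out x p y + out p x y + out y x p
            ≡⟨ arcs-distinct xpy ⟨
          arcs x p y ∎
          where open ≤-Reasoning

        _∈₁ : Fin n → Set
        _∈₁ = Member x p y

        common-vertex : ∀ {v} → v ∈₀ → v ∈₁ → v ≡ x
        common-vertex _ (inj₁ v≡x) = v≡x
        common-vertex (inj₁ v≡x) _ = v≡x
        common-vertex (inj₂ (inj₁ refl)) (inj₂ (inj₁ q≡p)) = contradiction (sym q≡p) p≢q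
        common-vertex (inj₂ (inj₁ refl)) (inj₂ (inj₂ q≡y)) = contradiction (sym q≡y) y≢q
        common-vertex (inj₂ (inj₂ refl)) (inj₂ (inj₁ r≡p)) = contradiction (sym r≡p) p≢r
        common-vertex (inj₂ (inj₂ refl)) (inj₂ (inj₂ r≡y)) = contradiction (sym r≡y) y≢r

        χ*χ≡0 : ∀ {u v} → u ≢ v → u ∈₁ → v ∈₁ → χ x q r u * χ x q r v ≡ 0
        χ*χ≡0 {u} {v} u≢v u∈ v∈ = go (member? x q r u) (member? x q r v)
          where
          go : Dec (u ∈₀) → Dec (v ∈₀) → χ x q r u * χ x q r v ≡ 0
          go (no u∉) _ = cong (_* χ x q r v) (⟦⟧-no (member? x q r u) u∉)
          go (yes _) (no v∉) = trans (cong (χ x q r u *_) (⟦⟧-no (member? x q r v) v∉)) (*-zeroʳ (χ x q r u))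
          go (yes u∈₀) (yes v∈₀) = contradiction (trans (common-vertex u∈₀ u∈) (sym (common-vertex v∈₀ v∈))) u≢v

        -- The triple {x , p , y} always has a spare arc (ξ); it meets {x , q , r}
        -- only in x, so it is not among the odd triples credited there.  The
        -- triple {x , q , r} itself may lack one arc, hence the allowance κ.
        ξ κ : Triple n
        ξ a b c = χ³ x p y a b c * D a b c
        κ a b c = 2 * (χ³ x q r a b c * D a b c)

        Bound : Fin n → Fin n → Fin n → Set
        Bound a b c = 2 * edges₃ a b c + ξ a b c + χ-pairs x q r a b c * parity a b c
                      ≤ arcs a b c + 2 * (χ³ x q r a b c * parity a b c) + κ a b c

        bound-degenerate : ∀ {a b c} → D a b c ≡ 0 → edges₃ a b c ≡ 0 → parity a b c ≡ 0 → Bound a b c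
        bound-degenerate {a} {b} {c} D≡0 e≡0 o≡0 = ≤-trans (≤-reflexive (begin
          2 * edges₃ a b c + ξ a b c + χ-pairs x q r a b c * parity a b c
            ≡⟨ cong₂ _+_ (cong₂ (λ u v → 2 * u + χ³ x p y a b c * v) e≡0 D≡0) (cong (χ-pairs x q r a b c *_) o≡0) ⟩
          χ³ x p y a b c * 0 + χ-pairs x q r a b c * 0
            ≡⟨ cong₂ _+_ (*-zeroʳ (χ³ x p y a b c)) (*-zeroʳ (χ-pairs x q r a b c)) ⟩
          0 ∎)) z≤n
          where open ≡-Reasoning

        -- No two vertices of `{x , p , y}` lie in `{x , q , r}`, so the parity term vanishes and
        -- the spare arc pays for `ξ`.
        bound-at-xpy : ∀ {a b c} → Distinct a b c → a ∈₁ → b ∈₁ → c ∈₁ → Bound a b c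
        bound-at-xpy {a} {b} {c} abc@(a≢b , a≢c , b≢c) a∈ b∈ c∈ = begin
          2 * edges₃ a b c + ξ a b c + χ-pairs x q r a b c * parity a b c
            ≡⟨ cong₂ (λ u v → 2 * edges₃ a b c + u + v * parity a b c) ξ≡1
                 (cong₂ _+_ (cong₂ _+_ (χ*χ≡0 a≢b a∈ b∈) (χ*χ≡0 a≢c a∈ c∈)) (χ*χ≡0 b≢c b∈ c∈)) ⟩
          2 * edges₃ a b c + 1 + 0
            ≡⟨ +-identityʳ _ ⟩
          2 * edges₃ a b c + 1
            ≤⟨ permutation-elim x p y Wasteful
                 (λ {a} {b} {c} → subst₂ (λ u v → 2 * u + 1 ≤ v)
                   (swap₁₂ edges₃-symmetric a b c) (swap₁₂ arcs-symmetric a b c))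
                 (λ {a} {b} {c} → subst₂ (λ u v → 2 * u + 1 ≤ v)
                   (swap₂₃ edges₃-symmetric a b c) (swap₂₃ arcs-symmetric a b c))
                 xpy-wasteful abc a∈ b∈ c∈ ⟩
          arcs a b c
            ≤⟨ ≤-trans (m≤m+n _ _) (m≤m+n _ _) ⟩
          arcs a b c + 2 * (χ³ x q r a b c * parity a b c) + κ a b c ∎
          where
          open ≤-Reasoning
          Wasteful : Fin n → Fin n → Fin n → Set
          Wasteful a b c = 2 * edges₃ a b c + 1 ≤ arcs a b c
          ξ≡1 : ξ a b c ≡ 1
          ξ≡1 = cong₂ _*_ (χ³≡1 x p y a b c a∈ b∈ c∈) (D-distinct abc)

        bound-elsewhere : ∀ {a b c} → ξ a b c ≡ 0 →
                          2 * edges₃ a b c + parity a b c ≤ arcs a b c + κ a b c → Bound a b c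
        bound-elsewhere {a} {b} {c} ξ≡0 h = begin
          2 * edges₃ a b c + ξ a b c + χ-pairs x q r a b c * parity a b c
            ≡⟨ cong (_+ χ-pairs x q r a b c * parity a b c) 
                 (trans (cong (2 * edges₃ a b c +_) ξ≡0) (+-identityʳ _)) ⟩
          2 * edges₃ a b c + χ-pairs x q r a b c * parity a b c
            ≤⟨ +-monoʳ-≤ (2 * edges₃ a b c) (χ-pairs-bound x q r a b c (parity a b c)) ⟩
          2 * edges₃ a b c + (parity a b c + 2 * (χ³ x q r a b c * parity a b c))
            ≡⟨ +-assoc (2 * edges₃ a b c) _ _ ⟨
          2 * edges₃ a b c + parity a b c + 2 * (χ³ x q r a b c * parity a b c)
            ≤⟨ +-monoˡ-≤ _ h ⟩
          arcs a b c + κ a b c + 2 * (χ³ x q r a b c * parity a b c)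
            ≡⟨ rearrange (arcs a b c) (κ a b c) _ ⟩
          arcs a b c + 2 * (χ³ x q r a b c * parity a b c) + κ a b c ∎
          where
          open ≤-Reasoning
          rearrange : ∀ u v w → u + v + w ≡ u + w + v
          rearrange = solve-∀

        -- A crude estimate suffices: `κ` pays for the edge and `arcs` for its own parity.
        bound-inside : ∀ {a b c} → Distinct a b c → a ∈₀ → b ∈₀ → c ∈₀ →
                       2 * edges₃ a b c + parity a b c ≤ arcs a b c + κ a b c
        bound-inside {a} {b} {c} abc a∈ b∈ c∈ = begin
          2 * edges₃ a b c + parity a b c
            ≤⟨ +-mono-≤ (*-monoʳ-≤ 2 edges₃≤1) (m%n≤m (arcs a b c) 2) ⟩
          2 + arcs a b c
            ≡⟨ +-comm 2 (arcs a b c) ⟩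
          arcs a b c + 2
            ≡⟨ cong (arcs a b c +_) (cong (2 *_) κ′≡1) ⟨
          arcs a b c + κ a b c ∎
          where
          open ≤-Reasoning
          edges₃≤1 : edges₃ a b c ≤ 1
          edges₃≤1 = [ (λ eq → ≤-trans (≤-reflexive eq) z≤n) , ≤-reflexive ∘ proj₁ ]′ (edges₃-cases a b c)
          κ′≡1 : χ³ x q r a b c * D a b c ≡ 1
          κ′≡1 = cong₂ _*_ (χ³≡1 x q r a b c a∈ b∈ c∈) (D-distinct abc)

        bound : ∀ a b c → Bound a b c
        bound a b c = go (distinct? a b c) (member? x p y a ×-dec member? x p y b ×-dec member? x p y c)
                         (member? x q r a ×-dec member? x q r b ×-dec member? x q r c)
          where
          vanish : ∀ {F} → Symmetric₃ F → ¬ Distinct a b c → F a b c ≡ 0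
          vanish S ¬abc = [ (λ abc → contradiction abc ¬abc) , id ]′ (Distinct-elim S a b c)
          go : Dec (Distinct a b c) → Dec (a ∈₁ × b ∈₁ × c ∈₁) → Dec (a ∈₀ × b ∈₀ × c ∈₀) → Bound a b c
          go (no ¬abc) _ _ = 
            bound-degenerate (vanish D-symmetric ¬abc) (vanish edges₃-symmetric ¬abc) (vanish parity-symmetric ¬abc)
          go (yes abc) (yes (a∈ , b∈ , c∈)) _ = bound-at-xpy abc a∈ b∈ c∈
          go (yes abc) (no ∉₁) (yes (a∈ , b∈ , c∈)) =
            bound-elsewhere (cong (_* D a b c) (χ³≡0 x p y a b c ∉₁)) (bound-inside abc a∈ b∈ c∈)
          go (yes abc) (no ∉₁) (no ∉₀) = bound-elsewhere (cong (_* D a b c) (χ³≡0 x p y a b c ∉₁))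
            (≤-trans (covered-bound a b c ([ id , (λ ∈₀ → contradiction ∈₀ ∉₀) ]′ ∘ covered-or-inside)) (m≤m+n _ _))

        -- Per 3-set, that is after division by 6, the odd 3-sets leave an excess of 2, `κ` adds 2,
        -- and `ξ` takes 1 away, hence the 3.
        uncovered-bound : parity x q r ≡ 1 → 2 * size H + n ≤ n * (n ∸ 2) + 3
        uncovered-bound odd = *-cancelˡ-≤ 6 (+-cancelʳ-≤ 6 _ _ (begin
          6 * (2 * size H + n) + 6
            ≡⟨ lhs (size H) n ⟩
          2 * (6 * size H) + 6 + 6 * n
            ≡⟨ cong₂ (λ s z → 2 * s + z + 6 * n) ∑³-edges₃
                 (trans (∑³-χ³ x p y xpy D-symmetric) (cong (6 *_) (D-distinct xpy))) ⟨
          2 * ∑³ edges₃ + ∑³ ξ + 6 * n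
            ≤⟨ odd-triples-bound xqr odd edges₃ ξ κ bound ⟩
          6 * (n * (n ∸ 2)) + 12 + ∑³ κ
            ≡⟨ cong (6 * (n * (n ∸ 2)) + 12 +_) (trans (∑³-*ˡ 2 (λ a b c → χ³ x q r a b c * D a b c))
                 (cong (2 *_) (trans (∑³-χ³ x q r xqr D-symmetric) (cong (6 *_) (D-distinct xqr))))) ⟩
          6 * (n * (n ∸ 2)) + 12 + 12
            ≡⟨ rhs (n * (n ∸ 2)) ⟩
          6 * (n * (n ∸ 2) + 3) + 6 ∎))
          where
          open ≤-Reasoning
          lhs : ∀ s k → 6 * (2 * s + k) + 6 ≡ 2 * (6 * s) + 6 + 6 * k
          lhs = solve-∀
          rhs : ∀ k → 6 * k + 12 + 12 ≡ 6 * (k + 3) + 6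
          rhs = solve-∀

      -- If `{x , q , r}` keeps two vertices or carries no edge, every 3-set is covered. Otherwise
      -- it is odd, and `y` supplies the compensating waste.
      one-triangle-bound : 4 < n → ¬ 2 ∣ n * (n ∸ 2) → 2 * size H + n ≤ n * (n ∸ 2) + 3
      one-triangle-bound 4<n odd with fresh 4<n x p q r
      ... | y , y≢x , y≢p , y≢q , y≢r with 2 ≤? arcs x q r | edge? H x q r ⊎-dec edge? H x r q ⊎-dec edge? H q r x
      ... | yes 2≤ | _ = all-covered-bound odd (covered-everywhere λ _ → ⟨ 2≤ ⟩)
      ... | no _ | no ¬e = all-covered-bound odd (covered-everywhere λ e → contradiction e ¬e)
      ... | no few | yes e = uncovered-bound y≢x y≢p y≢q y≢r (xqr-odd e few)

choose-centres : ∀ {n} {P : Fin n → Fin n → Set} x (p : Fin n) → (∀ z → z ≢ x → ∃ (P z)) →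
  ∃ λ (f : Fin n → Fin n) → f x ≡ p × (∀ {z} → z ≢ x → P z (f z))
choose-centres {n} {P} x p centre = (λ z → pick z (z ≟ x)) , at-x (x ≟ x) , λ {z} z≢x → off-x (z ≟ x) z≢x
  where
  pick : ∀ z → Dec (z ≡ x) → Fin n
  pick z (yes _)   = p
  pick z (no z≢x) = proj₁ (centre z z≢x)
  at-x : (d : Dec (x ≡ x)) → pick x d ≡ p
  at-x (yes _)   = refl
  at-x (no x≢x) = contradiction refl x≢x
  off-x : ∀ {z} (d : Dec (z ≡ x)) → z ≢ x → P z (pick z d)
  off-x (yes z≡x) z≢x = contradiction z≡x z≢x
  off-x {z} (no z≢x) _ = proj₂ (centre z z≢x)

-- The upper bound.

module UpperBound {n : ℕ} (H : Graph n) (oriented : Oriented H) (free : (H₁ Free) H) where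

  2*size≡∑degree : 2 * size H ≡ ∑[ x < n ] degree H x
  2*size≡∑degree = 2*size≡∑³ H

  triangle-at : 4 < n → ∀ {x} → ¬ ∃ (Star H x) → Triangle H x
  -- Repeating `x` four times yields a vertex other than `x`.
  triangle-at 4<n {x} with fresh 4<n x x x x
  ... | z , z≢x , _ = triangle H free z≢x

  degree≤ : 4 < n → ∀ x → degree H x ≤ n ∸ 2
  degree≤ 4<n x with star? H x
  ... | yes (_ , star) = degree-star H oriented star
  -- From `4 < n` one gets `3 ≤ n ∸ 2`.
  ... | no ¬star = ≤-trans (degree-triangle H oriented (triangle-at 4<n ¬star)) (∸-monoˡ-≤ 2 4<n)

  2*size≤ : 4 < n → 2 * size H ≤ n * (n ∸ 2)
  2*size≤ 4<n = begin
    2 * size H              ≡⟨ 2*size≡∑degree ⟩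
    ∑[ x < n ] degree H x   ≤⟨ ∑-mono (degree≤ 4<n) ⟩
    ∑[ x < n ] (n ∸ 2)      ≡⟨ ∑-const n (n ∸ 2) ⟩
    n * (n ∸ 2)             ∎
    where open ≤-Reasoning

  6<n⇒4<n : 6 < n → 4 < n
  6<n⇒4<n = ≤-trans (m≤n+m 5 2)

  -- Each of the two vertices has degree at most 3, which is `n ∸ 5` below the general bound
  -- `n ∸ 2`. The total loss `2 * (n ∸ 5)` reaches `n ∸ 3` from `n = 7` on.
  two-triangles-bound : 6 < n → ∀ {x x′} → x ≢ x′ → ¬ ∃ (Star H x) → ¬ ∃ (Star H x′) →
                        2 * size H + n ≤ n * (n ∸ 2) + 3
  two-triangles-bound 6<n {x} {x′} x≢x′ ¬star ¬star′ = begin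
    2 * size H + n
      ≤⟨ +-monoʳ-≤ (2 * size H) (n≤2k+3 6<n) ⟩
    2 * size H + (2 * k + 3)
      ≡⟨ +-assoc (2 * size H) (2 * k) 3 ⟨
    2 * size H + 2 * k + 3
      ≡⟨ cong (_+ 3) (cong₂ _+_ 2*size≡∑degree (*-comm 2 k)) ⟩
    ∑[ z < n ] degree H z + k * 2 + 3
      ≡⟨ cong (λ s → ∑[ z < n ] degree H z + k * s + 3) 
           (trans (∑-distrib-+ (δ x) (δ x′)) (cong₂ _+_ (∑-δ₁ x) (∑-δ₁ x′))) ⟨
    ∑[ z < n ] degree H z + k * ∑[ z < n ] (δ x z + δ x′ z) + 3
      ≡⟨ cong (_+ 3) (trans (∑-distrib-+ (degree H) (λ z → k * (δ x z + δ x′ z)))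
           (cong (∑[ z < n ] degree H z +_) (∑-*ˡ k (λ z → δ x z + δ x′ z)))) ⟨
    ∑[ z < n ] (degree H z + k * (δ x z + δ x′ z)) + 3
      ≤⟨ +-monoˡ-≤ 3 (∑-mono λ z → pointwise z (x ≟ z) (x′ ≟ z)) ⟩
    ∑[ z < n ] (n ∸ 2) + 3
      ≡⟨ cong (_+ 3) (∑-const n (n ∸ 2)) ⟩
    n * (n ∸ 2) + 3 ∎
    where
    open ≤-Reasoning
    k = n ∸ 5
    4<n = 6<n⇒4<n 6<n
    n≤2k+3 : ∀ {n} → 6 < n → n ≤ 2 * (n ∸ 5) + 3
    n≤2k+3 (s≤s (s≤s (s≤s (s≤s (s≤s (s≤s (s≤s (z≤n {j})))))))) = ≤-trans (m≤m+n _ j) (≤-reflexive (solve j))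
      where solve : ∀ j → 7 + j + j ≡ 2 * (2 + j) + 3
            solve = solve-∀
    3+k≡n∸2 : ∀ {n} → 4 < n → 3 + (n ∸ 5) ≡ n ∸ 2
    3+k≡n∸2 (s≤s (s≤s (s≤s (s≤s (s≤s z≤n))))) = refl
    at-triangle : ∀ {z} → ¬ ∃ (Star H z) → δ x z + δ x′ z ≡ 1 → degree H z + k * (δ x z + δ x′ z) ≤ n ∸ 2
    at-triangle {z} ¬star eq = ≤-trans
      (+-mono-≤ (degree-triangle H oriented (triangle-at 4<n ¬star))
                (≤-reflexive (trans (cong (k *_) eq) (*-identityʳ k))))
      (≤-reflexive (3+k≡n∸2 4<n))
    pointwise : ∀ z → Dec (x ≡ z) → Dec (x′ ≡ z) → degree H z + k * (δ x z + δ x′ z) ≤ n ∸ 2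
    pointwise z (yes refl) _ = at-triangle ¬star (cong₂ _+_ (⟦⟧-yes (x ≟ x) refl) (⟦⟧-no (x′ ≟ x) (≢-sym x≢x′)))
    pointwise z (no x≢z) (yes refl) = at-triangle ¬star′ (cong₂ _+_ (⟦⟧-no (x ≟ z) x≢z) (⟦⟧-yes (x′ ≟ x′) refl))
    pointwise z (no x≢z) (no x′≢z) = ≤-trans (≤-reflexive
      (trans (cong (λ s → degree H z + k * s) (cong₂ _+_ (⟦⟧-no (x ≟ z) x≢z) (⟦⟧-no (x′ ≟ z) x′≢z)))
             (trans (cong (degree H z +_) (*-zeroʳ k)) (+-identityʳ _)))) (degree≤ 4<n z)

  odd-bound : 6 < n → ¬ 2 ∣ n * (n ∸ 2) → 2 * size H + n ≤ n * (n ∸ 2) + 3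
  odd-bound 6<n odd with any? (λ x → ¬? (star? H x))
  ... | no none = all-stars-bound odd (λ x → proj₂ (centre x))
    where
    centre : ∀ x → ∃ (Star H x)
    centre x with star? H x
    ... | yes s = s
    ... | no ¬s = contradiction (x , ¬s) none
    open StarCentres H oriented (proj₁ ∘ centre) (λ x → proj₁ (proj₂ (centre x)))
  ... | yes (x , ¬star) with any? (λ x′ → ¬? (x ≟ x′) ×-dec ¬? (star? H x′))
  ... | yes (x′ , x≢x′ , ¬star′) = two-triangles-bound 6<n x≢x′ ¬star ¬star′
  ... | no none = one-triangle-bound T fx≡p stars 4<n odd
    where
    4<n = 6<n⇒4<n 6<n
    T : Triangle H x
    T = triangle-at 4<n ¬star
    centre : ∀ z → z ≢ x → ∃ (Star H z)
    centre z z≢x with star? H z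
    ... | yes s = s
    ... | no ¬s = contradiction (z , ≢-sym z≢x , ¬s) none
    centres = choose-centres x (Triangle.p T) centre
    f = proj₁ centres
    fx≡p = proj₁ (proj₂ centres)
    stars : ∀ {z} → z ≢ x → Star H z (f z)
    stars = proj₂ (proj₂ centres)
    f-irrefl : ∀ z → f z ≢ z
    f-irrefl z = go (z ≟ x)
      where
      go : Dec (z ≡ x) → f z ≢ z
      go (yes refl) fx≡x = Triangle.p≢x T (trans (sym fx≡p) fx≡x)
      go (no z≢x) = proj₁ (stars z≢x)
    open StarCentres H oriented f f-irrefl
    open OneTriangle

even-or-odd : ∀ n → n ≡ 2 * ⌊ n /2⌋ ⊎ n ≡ suc (2 * ⌊ n /2⌋)
even-or-odd zero = inj₁ refl
even-or-odd (suc zero) = inj₂ refl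
even-or-odd (suc (suc n)) with even-or-odd n
... | inj₁ eq = inj₁ (trans (cong (2 +_) eq) (sym (*-suc 2 ⌊ n /2⌋)))
... | inj₂ eq = inj₂ (cong suc (trans (cong suc eq) (sym (*-suc 2 ⌊ n /2⌋))))

size≤ : ∀ {n} → n ≥ 6 → (H : Graph n) → Oriented H → (H₁ Free) H → size H ≤ ⌊ n /2⌋ * (n ∸ 2)
size≤ {n} n≥6 H oriented free with even-or-odd n
... | inj₁ n≡2h = *-cancelˡ-≤ 2 (begin
  2 * size H                   ≤⟨ 2*size≤ (≤-trans (n≤1+n 5) n≥6) ⟩
  n * (n ∸ 2)                  ≡⟨ cong (_* (n ∸ 2)) n≡2h ⟩
  2 * ⌊ n /2⌋ * (n ∸ 2)        ≡⟨ *-assoc 2 ⌊ n /2⌋ (n ∸ 2) ⟩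
  2 * (⌊ n /2⌋ * (n ∸ 2))      ∎)
  where
  open ≤-Reasoning
  open UpperBound H oriented free
... | inj₂ n≡1+2h = odd-case ⌊ n /2⌋ n≡1+2h
  where
  open ≤-Reasoning
  open UpperBound H oriented free
  6<n : 6 < n
  -- An odd `n` is not 6.
  6<n = ≤∧≢⇒< n≥6 λ { refl → contradiction n≡1+2h λ () }
  odd-case : ∀ h → n ≡ suc (2 * h) → size H ≤ h * (n ∸ 2)
  odd-case zero n≡1 = contradiction (subst (6 <_) n≡1 6<n) λ { (s≤s ()) }
  -- It is enough to bound `2 * size H` by one more than twice the target, because `2 * size H` is
  -- even.
  odd-case (suc h) n≡ = s≤s⁻¹ (*-cancelˡ-< 2 (size H) (suc (suc h * (n ∸ 2)))
    (≤-trans (s≤s 2*size≤1+) (≤-reflexive (sym (*-suc 2 (suc h * (n ∸ 2)))))))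
    where
    n≡3+2h : n ≡ 3 + 2 * h
    n≡3+2h = trans n≡ (cong suc (*-suc 2 h))
    -- The constant 3 in `odd-bound` exceeds twice the target by exactly that one unit.
    solve : ∀ h → (3 + 2 * h) * (1 + 2 * h) + 3 ≡ suc (2 * (suc h * (1 + 2 * h))) + (3 + 2 * h)
    solve = solve-∀
    odd-product : ∀ h → (3 + 2 * h) * (1 + 2 * h) ≡ 2 * (1 + 4 * h + 2 * h * h) + 1
    odd-product = solve-∀
    odd : ¬ 2 ∣ n * (n ∸ 2)
    odd even = contradiction
      (∣m+n∣m⇒∣n (subst (2 ∣_) (trans (cong (λ n → n * (n ∸ 2)) n≡3+2h) (odd-product h)) even)
                 (m∣m*n (1 + 4 * h + 2 * h * h)))
      (>⇒∤ ≤-refl)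
    2*size≤1+ : 2 * size H ≤ suc (2 * (suc h * (n ∸ 2)))
    2*size≤1+ = +-cancelʳ-≤ n _ _ (begin
      2 * size H + n                                 ≤⟨ odd-bound 6<n odd ⟩
      n * (n ∸ 2) + 3                                ≡⟨ cong (λ n → n * (n ∸ 2) + 3) n≡3+2h ⟩
      (3 + 2 * h) * (1 + 2 * h) + 3                  ≡⟨ solve h ⟩
      suc (2 * (suc h * (1 + 2 * h))) + (3 + 2 * h)  ≡⟨ cong (λ n → suc (2 * (suc h * (n ∸ 2))) + n) n≡3+2h ⟨
      suc (2 * (suc h * (n ∸ 2))) + n                ∎)

-- The extremal graph.

-- The matching pairs consecutive vertices. For odd `n` the last one is its own partner, and
-- `Distinct` then keeps it out of all tails.
partner : ∀ {n} → Fin n → Fin n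
partner {suc zero}    zero          = zero
partner {suc (suc n)} zero          = suc zero
partner {suc (suc n)} (suc zero)    = zero
partner {suc (suc n)} (suc (suc i)) = suc (suc (partner i))

partner-involutive : ∀ {n} (i : Fin n) → partner (partner i) ≡ i
partner-involutive {suc zero}    zero          = refl
partner-involutive {suc (suc n)} zero          = refl
partner-involutive {suc (suc n)} (suc zero)    = refl
partner-involutive {suc (suc n)} (suc (suc i)) = cong (λ i → suc (suc i)) (partner-involutive i)

∑-paired : ∀ n → ∑[ i < n ] ⟦ ¬? (i ≟ partner i) ⟧ ≡ 2 * ⌊ n /2⌋
∑-paired zero          = refl
∑-paired (suc zero)    = refl
∑-paired (suc (suc n)) = trans (cong (2 +_) (∑-paired n)) (sym (*-suc 2 ⌊ n /2⌋))

⟦⟧-× : ∀ {P Q : Set} (p : Dec P) (q : Dec Q) → ⟦ p ×-dec q ⟧ ≡ ⟦ p ⟧ * ⟦ q ⟧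
⟦⟧-× (yes _) (yes _) = refl
⟦⟧-× (yes _) (no _)  = refl
⟦⟧-× (no _)  _       = refl

module _ (n : ℕ) where

  pairGraph : Graph n
  pairGraph .Edge a b c = partner a ≡ b × Distinct a b c
  pairGraph .edge? a b c = partner a ≟ b ×-dec distinct? a b c
  pairGraph .tail-sym {a} (refl , abc) = partner-involutive a , Distinct-swap₁₂ abc
  pairGraph .distinct = proj₂

  -- Two different tails inside one 3-set share a vertex, which would have two partners.
  pairGraph-oriented : Oriented pairGraph
  pairGraph-oriented a b c (refl , _ , a≢c , b≢c) = (λ (b≡c , _) → b≢c b≡c) ,
                                                     λ (a≡c , _) → a≢c (trans (sym (partner-involutive a)) a≡c)

  -- Both tails of `H₁` contain `x`, so the images of `a` and `c` would be the same partner of the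
  -- image of `x`.
  pairGraph-free : (H₁ Free) pairGraph
  pairGraph-free (φ , injective , embed)
    with embed 0F 4F 1F (here refl) | embed 2F 4F 3F (there (there (here refl)))
  ... | ax , _ | cx , _ = contradiction (injective (begin
      φ 0F                      ≡⟨ partner-involutive (φ 0F) ⟨
      partner (partner (φ 0F))  ≡⟨ cong partner (trans ax (sym cx)) ⟩
      partner (partner (φ 2F))  ≡⟨ partner-involutive (φ 2F) ⟩
      φ 2F                      ∎)) λ ()
    where open ≡-Reasoning

  -- Each of the `2 * ⌊ n /2⌋` paired vertices determines its tail and leaves `n ∸ 2` heads; this
  -- counts every edge at both orderings of its tail.
  size-pairGraph : size pairGraph ≡ ⌊ n /2⌋ * (n ∸ 2)
  size-pairGraph = *-cancelˡ-≡ _ _ 2 (begin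
    2 * size pairGraph
      ≡⟨ 2*size≡∑³ pairGraph ⟩
    ∑³ (edges pairGraph)
      ≡⟨ ∑³-cong {n} (λ a b c → ⟦⟧-× (partner a ≟ b) (distinct? a b c)) ⟩
    ∑³ {n} (λ a b c → δ (partner a) b * D a b c)
      ≡⟨ ∑³-δ-D {n} partner ⟩
    ∑[ a < n ] sum (D a (partner a))
      ≡⟨ sum-cong-≗ {n} (λ a → heads a (a ≟ partner a)) ⟩
    ∑[ a < n ] ((n ∸ 2) * ⟦ ¬? (a ≟ partner a) ⟧)
      ≡⟨ ∑-*ˡ {n} (n ∸ 2) (λ a → ⟦ ¬? (a ≟ partner a) ⟧) ⟩
    (n ∸ 2) * ∑[ a < n ] ⟦ ¬? (a ≟ partner a) ⟧
      ≡⟨ cong ((n ∸ 2) *_) (∑-paired n) ⟩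
    (n ∸ 2) * (2 * ⌊ n /2⌋)
      ≡⟨ rearrange (n ∸ 2) ⌊ n /2⌋ ⟩
    2 * (⌊ n /2⌋ * (n ∸ 2)) ∎)
    where
    open ≡-Reasoning
    rearrange : ∀ k h → k * (2 * h) ≡ 2 * (h * k)
    rearrange = solve-∀
    heads : ∀ a → Dec (a ≡ partner a) → sum (D a (partner a)) ≡ (n ∸ 2) * ⟦ ¬? (a ≟ partner a) ⟧
    heads a (yes a≡) = trans (∑-zero λ c → ⟦⟧-no (distinct? a (partner a) c) (λ (a≢ , _) → a≢ a≡))
      (sym (trans (cong ((n ∸ 2) *_) (⟦⟧-no (¬? (a ≟ partner a)) (λ a≢ → a≢ a≡))) (*-zeroʳ (n ∸ 2))))
    heads a (no a≢) = trans (∑-D∸ a≢)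
      (sym (trans (cong ((n ∸ 2) *_) (⟦⟧-yes (¬? (a ≟ partner a)) a≢)) (*-identityʳ (n ∸ 2))))

theorem4p1 : ∀ (n : ℕ) → n ≥ 6 → exₒ[ n , H₁ ]≡ (⌊ n /2⌋ * (n ∸ 2))
theorem4p1 n n≥6 = (pairGraph n , pairGraph-oriented n , pairGraph-free n , size-pairGraph n) ,
                   λ H → size≤ n≥6 H
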